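{- Let $p<q<r$ be odd primes with $r<(p-1)(q-1)/(p-2)$, and write $\Psi_{pqr}(x)=\sum_k c_{pqr}(k)x^k$. (i) If $q\equiv -1\pmod p$ and $r\equiv -1\pmod p$, then $c_{pqr}(mr)=-1-m$ and $c_{pqr}((m+q)r)=m+1$ for every $0\le m\le p-2$, $c_{pqr}(2)=0$, and $V_{pqr}=\{ -(p-1),-(p-2),\ldots,p-2,p-1\}$. (ii) If $q\equiv 1\pmod p$ and $r\equiv 1\pmod p$, then $c_{pqr}(1+mr)=1+m$ and $c_{pqr}(1+(m+q)r)=-1-m$ for every $0\le m\le p-2$, $c_{pqr}(2)=0$, and $V_{pqr}=\{ -(p-1),-(p-2),\ldots,p-2,p-1\}$.
   Context: $\Phi_n(x)$ is the $n$-th cyclotomic polynomial, $\varphi$ is Euler's totient function, and $\Psi_n(x)=(x^n-1)/\Phi_n(x)=\sum_{k=0}^{n-\varphi(n)}c_n(k)x^k\in\mathbb Z[x]$. $V_n=\{c_n(k):0\le k\le n-\varphi(n)\}$ is the set of coefficient values of $\Psi_n$. -}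

module Defs where

open import Data.Nat as ℕ using (ℕ; zero; suc; _∸_; _<ᵇ_)
open import Data.Nat.Divisibility using (_∣?_)
open import Data.Nat.GCD using (gcd)
open import Data.Integer as ℤ using (ℤ; +_)
open import Data.List using (List; []; _∷_; map; length; reverse; replicate; _++_; filter; upTo)
open import Data.Bool using (if_then_else_)
open import Relation.Nullary.Decidable using (does)
open import Relation.Binary.PropositionalEquality using (_≡_)

-- Polynomials over ℤ as coefficient lists, lowest degree first.
Poly : Set
Poly = List ℤ

addP : Poly → Poly → Poly
addP [] q = q
addP p [] = p
addP (a ∷ p) (b ∷ q) = (a ℤ.+ b) ∷ addP p q

mulP : Poly → Poly → Poly
mulP [] q = []
mulP (a ∷ p) q = addP (map (a ℤ.*_) q) (+ 0 ∷ mulP p q)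

oneP : Poly
oneP = + 1 ∷ []

xnMinus1 : ℕ → Poly
xnMinus1 zero = []
xnMinus1 (suc n) = ℤ.-[1+ 0 ] ∷ (replicate n (+ 0) ++ (+ 1 ∷ []))

-- subtract the second list from a prefix of the first (highest degree first)
subHF : List ℤ → List ℤ → List ℤ
subHF (x ∷ xs) (y ∷ ys) = (x ℤ.- y) ∷ subHF xs ys
subHF xs [] = xs
subHF [] ys = map ℤ.-_ ys

-- long-division quotient of a (highest degree first) by the monic
-- polynomial whose non-leading coefficients (highest first) are bt
quotHF : ℕ → List ℤ → List ℤ → List ℤ
quotHF zero bt a = []
quotHF (suc f) bt [] = []
quotHF (suc f) bt (c ∷ as) =
  if length as <ᵇ length bt then []
  else c ∷ quotHF f bt (subHF as (map (c ℤ.*_) bt))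

divMonic : Poly → Poly → Poly
divMonic a b with reverse b
... | [] = []
... | _ ∷ bt = reverse (quotHF (length a) bt (reverse a))

-- product of the table entries Φ_d (table = Φ_1, ..., Φ_m, starting
-- at index d) with d ∣ n
prodDivisors : ℕ → ℕ → List Poly → Poly
prodDivisors n d [] = oneP
prodDivisors n d (φ ∷ tbl) =
  if does (d ∣? n) then mulP φ (prodDivisors n (suc d) tbl)
  else prodDivisors n (suc d) tbl

-- cyclotomicTable n = Φ_1, ..., Φ_n, where Φ_k is defined recursively by
-- x^k - 1 = ∏_{d ∣ k} Φ_d(x), i.e. Φ_k = (x^k - 1) / ∏_{d ∣ k, d < k} Φ_d.
cyclotomicTable : ℕ → List Poly
cyclotomicTable zero = []
cyclotomicTable (suc n) =
  cyclotomicTable n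
    ++ (divMonic (xnMinus1 (suc n)) (prodDivisors (suc n) 1 (cyclotomicTable n)) ∷ [])

-- Ψ_n(x) = (x^n - 1)/Φ_n(x) = ∏_{d ∣ n, d < n} Φ_d(x)   (n ≥ 1)
Psi : ℕ → Poly
Psi n = prodDivisors n 1 (cyclotomicTable (n ∸ 1))

coeff : Poly → ℕ → ℤ
coeff [] k = + 0
coeff (a ∷ p) zero = a
coeff (a ∷ p) (suc k) = coeff p k

c : ℕ → ℕ → ℤ
c n k = coeff (Psi n) k

totient : ℕ → ℕ
totient n = length (filter (λ k → gcd (suc k) n ℕ.≟ 1) (upTo n))

{-# OPTIONS --safe #-}

-- Since Φ_pqr(x) = Φ_pq(x^r)/Φ_pq(x), we have Ψ_pqr(x) = Φ_pq(x) Ψ_pq(x^r), where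
-- Ψ_pq(x) = (x^q - 1)(1 + x + ⋯ + x^(p-1)). As a power series Φ_pq(x) = (1 - x) Σ x^s over
-- the numerical semigroup generated by p and q, so its coefficients are differences of
-- consecutive values of an indicator. Hence c(k) is ± a sum of coefficients of Φ_pq at
-- arguments k - jr of which at most p - 1 lie in the support, giving |c(k)| ≤ p - 1; when
-- q ≡ r ≡ ∓1 (mod p) the coefficients of Φ_pq at the arguments ir, respectively 1 + ir, are all
-- 1, respectively -1, for i ≤ p - 2, and the partial sums run through all values.
module Submission where

open import Defs
open import Data.Nat using (ℕ; zero; suc; _+_; _*_; _∸_; _<_; _≤_; z≤n; s≤s; _<ᵇ_; _≟_; >-nonZero; nonTrivial⇒n>1)
open import Data.Nat.Properties as ℕ using ()
open import Data.Nat.Divisibility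
open import Data.Nat.DivMod using (_%_; _/_; m%n<n; m≡m%n+[m/n]*n)
open import Data.Nat.GCD using (gcd; gcd-greatest; module Bézout)
open import Data.Nat.Coprimality as Coprime using (Coprime; coprime-divisor; coprime-Bézout)
open import Data.Nat.Primality using (Prime; prime⇒irreducible; prime⇒nonZero; prime⇒nonTrivial; ¬prime[0]; ¬prime[1])
open import Data.Nat.Tactic.RingSolver using () renaming (solve-∀ to solveℕ-∀)
open import Data.Integer as ℤ using (ℤ; +_; -[1+_])
open import Data.Integer.Properties as ℤ using ()
open import Data.Integer.Tactic.RingSolver using (solve-∀)
open import Data.Bool using (true; false; T; if_then_else_)
open import Data.List using (List; []; _∷_; _++_; map; length; reverse; replicate; foldr; applyUpTo; filter; upTo)
open import Data.List.Properties using (length-map; length-reverse; length-++; unfold-reverse; reverse-++;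
  reverse-involutive; reverse-map; filter-++; applyUpTo-∷ʳ; upTo-∷ʳ)
open import Data.List.Membership.Propositional using (_∈_)
open import Data.List.Relation.Unary.Any using (here; there)
open import Data.List.Relation.Unary.All as All using ()
open import Data.List.Relation.Unary.AllPairs using (AllPairs; _∷_)
open import Data.List.Relation.Unary.Linked using ([-]; _∷_)
open import Data.List.Relation.Unary.Linked.Properties using (Linked⇒AllPairs)
open import Data.Product using (_×_; _,_; proj₁; proj₂; ∃-syntax)
open import Data.Sum using (_⊎_; inj₁; inj₂; [_,_]′; map₂; fromInj₁; fromInj₂)
open import Data.Unit using (tt)
open import Function.Bundles using (_⇔_; mk⇔)
open import Relation.Binary.PropositionalEquality
open import Relation.Nullary using (¬_; Dec; yes; no; does; contradiction)
open import Relation.Unary using (Pred; Decidable)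
open import Algebra.Bundles using (CommutativeMonoid)
open import Algebra.Properties.CommutativeSemigroup ℕ.+-commutativeSemigroup using (x∙yz≈y∙xz; xy∙z≈xz∙y)
import Algebra.Solver.CommutativeMonoid as MonoidSolver

-- Polynomials acting on power series

-- Two obstacles shape the proof. A coefficient list may end in zeros, and 1/(x^p - 1) is no
-- polynomial; so polynomials act on sequences, everything is compared coefficientwise, and x^n - 1
-- can always be cancelled, being invertible as a power series. Moreover, Φ is the output of a long
-- division: a cyclotomic polynomial is recognised by exhibiting a finitely supported exact
-- quotient, and a degree argument shows that the division finds it. The hypotheses enter
-- arithmetically. The bound on r gives ir < (i+1)(q-1) for all i ≤ p-2, which keeps the critical
-- argument (ir - 1 or ir + 1) below the least semigroup element of its residue class modulo p. In
-- both cases r ≡ q (mod p) and 2p ≤ q + 1. The latter makes Φ_pq(x)(1 + x^r + ⋯ + x^((p-1)r)) end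
-- before x^(qr), so its two copies in Ψ_pqr, with opposite signs, do not overlap.

Seq : Set
Seq = ℕ → ℤ

shift : Seq → Seq
shift f zero    = + 0
shift f (suc k) = f k

act : Poly → Seq → Seq
act []      f k = + 0
act (a ∷ p) f k = a ℤ.* f k ℤ.+ shift (act p f) k

shift-cong : ∀ {f g} → f ≗ g → shift f ≗ shift g
shift-cong f≗g zero    = refl
shift-cong f≗g (suc k) = f≗g k

act-cong : ∀ p {f g} → f ≗ g → act p f ≗ act p g
act-cong []      f≗g k = refl
act-cong (a ∷ p) f≗g k =
  cong₂ (λ x y → a ℤ.* x ℤ.+ y) (f≗g k) (shift-cong (act-cong p f≗g) k)

shift-linear : ∀ a f g → shift (λ k → a ℤ.* f k ℤ.+ g k) ≗ (λ k → a ℤ.* shift f k ℤ.+ shift g k)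
shift-linear a f g zero    = cong (ℤ._+ + 0) (sym (ℤ.*-zeroʳ a))
shift-linear a f g (suc k) = refl

-- The shape a·f + g covers sums and scalar multiples in one law; a = 1 gives additivity.
act-linear : ∀ p a f g → act p (λ k → a ℤ.* f k ℤ.+ g k) ≗ (λ k → a ℤ.* act p f k ℤ.+ act p g k)
act-linear []      a f g k = cong (ℤ._+ + 0) (sym (ℤ.*-zeroʳ a))
act-linear (b ∷ p) a f g k = begin
  b ℤ.* (a ℤ.* f k ℤ.+ g k) ℤ.+ shift (act p (λ j → a ℤ.* f j ℤ.+ g j)) k
    ≡⟨ cong (ℤ._+_ (b ℤ.* (a ℤ.* f k ℤ.+ g k)))
         (trans (shift-cong (act-linear p a f g) k) (shift-linear a (act p f) (act p g) k)) ⟩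
  b ℤ.* (a ℤ.* f k ℤ.+ g k) ℤ.+ (a ℤ.* shift (act p f) k ℤ.+ shift (act p g) k)
    ≡⟨ rearrange a b (f k) (g k) _ _ ⟩
  a ℤ.* (b ℤ.* f k ℤ.+ shift (act p f) k) ℤ.+ (b ℤ.* g k ℤ.+ shift (act p g) k) ∎
  where
  open ≡-Reasoning
  rearrange : ∀ a b x y u v →
    b ℤ.* (a ℤ.* x ℤ.+ y) ℤ.+ (a ℤ.* u ℤ.+ v) ≡ a ℤ.* (b ℤ.* x ℤ.+ u) ℤ.+ (b ℤ.* y ℤ.+ v)
  rearrange = solve-∀

act-shift : ∀ p f → act p (shift f) ≗ shift (act p f)
act-shift []      f zero    = refl
act-shift []      f (suc k) = refl
act-shift (a ∷ p) f zero    = trans (ℤ.+-identityʳ _) (ℤ.*-zeroʳ a)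
act-shift (a ∷ p) f (suc k) = cong (ℤ._+_ (a ℤ.* f k)) (act-shift p f k)

act-zero : ∀ p → act p (λ _ → + 0) ≗ (λ _ → + 0)
act-zero []      k       = refl
act-zero (a ∷ p) zero    = trans (ℤ.+-identityʳ _) (ℤ.*-zeroʳ a)
act-zero (a ∷ p) (suc k) = cong₂ ℤ._+_ (ℤ.*-zeroʳ a) (act-zero p k)

act-comm : ∀ p q f → act p (act q f) ≗ act q (act p f)
act-comm []      q f k = sym (act-zero q k)
act-comm (a ∷ p) q f k = begin
  a ℤ.* act q f k ℤ.+ shift (act p (act q f)) k
    ≡⟨ cong (ℤ._+_ (a ℤ.* act q f k)) (shift-cong (act-comm p q f) k) ⟩
  a ℤ.* act q f k ℤ.+ shift (act q (act p f)) k
    ≡⟨ cong (ℤ._+_ (a ℤ.* act q f k)) (act-shift q (act p f) k) ⟨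
  a ℤ.* act q f k ℤ.+ act q (shift (act p f)) k
    ≡⟨ act-linear q a f (shift (act p f)) k ⟨
  act q (act (a ∷ p) f) k ∎
  where open ≡-Reasoning

coeff-addP : ∀ p q → coeff (addP p q) ≗ (λ k → coeff p k ℤ.+ coeff q k)
coeff-addP []      q       k       = sym (ℤ.+-identityˡ _)
coeff-addP (a ∷ p) []      k       = sym (ℤ.+-identityʳ _)
coeff-addP (a ∷ p) (b ∷ q) zero    = refl
coeff-addP (a ∷ p) (b ∷ q) (suc k) = coeff-addP p q k

coeff-map : ∀ a p → coeff (map (a ℤ.*_) p) ≗ (λ k → a ℤ.* coeff p k)
coeff-map a []      k       = sym (ℤ.*-zeroʳ a)
coeff-map a (b ∷ p) zero    = refl
coeff-map a (b ∷ p) (suc k) = coeff-map a p k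

coeff-0∷ : ∀ p → coeff (+ 0 ∷ p) ≗ shift (coeff p)
coeff-0∷ p zero    = refl
coeff-0∷ p (suc k) = refl

coeff-mulP : ∀ p q → coeff (mulP p q) ≗ act p (coeff q)
coeff-mulP []      q k = refl
coeff-mulP (a ∷ p) q k = trans (coeff-addP (map (a ℤ.*_) q) (+ 0 ∷ mulP p q) k)
  (cong₂ ℤ._+_ (coeff-map a q k)
    (trans (coeff-0∷ (mulP p q) k) (shift-cong (coeff-mulP p q) k)))

shift-zero : shift (λ _ → + 0) ≗ (λ _ → + 0)
shift-zero zero    = refl
shift-zero (suc _) = refl

act-null : ∀ p → (∀ k → coeff p k ≡ + 0) → ∀ f k → act p f k ≡ + 0
act-null []      p≗0 f k = refl
act-null (a ∷ p) p≗0 f k = cong₂ ℤ._+_ (cong (ℤ._* f k) (p≗0 0))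
  (trans (shift-cong (act-null p (λ i → p≗0 (suc i)) f) k) (shift-zero k))

-- Different lists can represent one polynomial, differing by trailing zeros; the extra zeros
-- contribute nothing to the product.
act-coeff : ∀ p q → coeff p ≗ coeff q → ∀ f → act p f ≗ act q f
act-coeff []      q       p≗q f k = sym (act-null q (λ j → sym (p≗q j)) f k)
act-coeff (a ∷ p) []      p≗q f k = act-null (a ∷ p) p≗q f k
act-coeff (a ∷ p) (b ∷ q) p≗q f k = cong₂ ℤ._+_ (cong (ℤ._* f k) (p≗q 0))
  (shift-cong (act-coeff p q (λ i → p≗q (suc i)) f) k)

act-addP : ∀ p q f → act (addP p q) f ≗ (λ k → act p f k ℤ.+ act q f k)
act-addP []      q       f k = sym (ℤ.+-identityˡ _)
act-addP (a ∷ p) []      f k = sym (ℤ.+-identityʳ _)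
act-addP (a ∷ p) (b ∷ q) f k = begin
  (a ℤ.+ b) ℤ.* f k ℤ.+ shift (act (addP p q) f) k
    ≡⟨ cong (ℤ._+_ ((a ℤ.+ b) ℤ.* f k)) (shift-cong (act-addP p q f) k) ⟩
  (a ℤ.+ b) ℤ.* f k ℤ.+ shift (λ j → act p f j ℤ.+ act q f j) k
    ≡⟨ cong (ℤ._+_ ((a ℤ.+ b) ℤ.* f k)) (shift-+ k) ⟩
  (a ℤ.+ b) ℤ.* f k ℤ.+ (shift (act p f) k ℤ.+ shift (act q f) k)
    ≡⟨ rearrange a b (f k) _ _ ⟩
  a ℤ.* f k ℤ.+ shift (act p f) k ℤ.+ (b ℤ.* f k ℤ.+ shift (act q f) k) ∎
  where
  open ≡-Reasoning
  shift-+ : shift (λ j → act p f j ℤ.+ act q f j) ≗ (λ j → shift (act p f) j ℤ.+ shift (act q f) j)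
  shift-+ zero    = refl
  shift-+ (suc _) = refl
  rearrange : ∀ a b x u v →
    (a ℤ.+ b) ℤ.* x ℤ.+ (u ℤ.+ v) ≡ a ℤ.* x ℤ.+ u ℤ.+ (b ℤ.* x ℤ.+ v)
  rearrange = solve-∀

act-map : ∀ a p f → act (map (a ℤ.*_) p) f ≗ (λ k → a ℤ.* act p f k)
act-map a []      f k       = sym (ℤ.*-zeroʳ a)
act-map a (b ∷ p) f zero    = begin
  a ℤ.* b ℤ.* f 0 ℤ.+ + 0     ≡⟨ ℤ.+-identityʳ _ ⟩
  a ℤ.* b ℤ.* f 0             ≡⟨ ℤ.*-assoc a b (f 0) ⟩
  a ℤ.* (b ℤ.* f 0)           ≡⟨ cong (a ℤ.*_) (ℤ.+-identityʳ _) ⟨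
  a ℤ.* (b ℤ.* f 0 ℤ.+ + 0)   ∎
  where open ≡-Reasoning
act-map a (b ∷ p) f (suc k) = trans
  (cong₂ ℤ._+_ (ℤ.*-assoc a b (f (suc k))) (act-map a p f k))
  (sym (ℤ.*-distribˡ-+ a _ _))

act-mulP : ∀ p q f → act (mulP p q) f ≗ act p (act q f)
act-mulP []      q f k = refl
act-mulP (a ∷ p) q f k = trans (act-addP (map (a ℤ.*_) q) (+ 0 ∷ mulP p q) f k)
  (cong₂ ℤ._+_ (act-map a q f k)
    (trans (ℤ.+-identityˡ _) (shift-cong (act-mulP p q f) k)))

act-oneP : ∀ p → act p (coeff oneP) ≗ coeff p
act-oneP []      k       = refl
act-oneP (a ∷ p) zero    = trans (ℤ.+-identityʳ _) (ℤ.*-identityʳ a)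
act-oneP (a ∷ p) (suc k) = trans (cong₂ ℤ._+_ (ℤ.*-zeroʳ a) (act-oneP p k)) (ℤ.+-identityˡ _)

oneP-act : ∀ f → act oneP f ≗ f
oneP-act f zero    = trans (ℤ.+-identityʳ _) (ℤ.*-identityˡ _)
oneP-act f (suc k) = trans (ℤ.+-identityʳ _) (ℤ.*-identityˡ _)

-- Equality up to trailing zeros. The record wrapper lets the two polynomials be inferred from the
-- type, which the bare pointwise equation would not.
infix 4 _≈_
record _≈_ (p q : Poly) : Set where
  constructor ≈-intro
  field coeffs : coeff p ≗ coeff q
open _≈_ public

-- The identities between products of cyclotomic polynomials are regroupings of factors, which the
-- monoid solver settles once this structure is available.
polyMonoid : CommutativeMonoid _ _
polyMonoid = record
  { Carrier = Poly ; _≈_ = _≈_ ; _∙_ = mulP ; ε = oneP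
  ; isCommutativeMonoid = record
    { isMonoid = record
      { isSemigroup = record
        { isMagma = record
          { isEquivalence = record
            { refl  = ≈-intro (λ _ → refl)
            ; sym   = λ e → ≈-intro (λ k → sym (coeffs e k))
            ; trans = λ e e′ → ≈-intro (λ k → trans (coeffs e k) (coeffs e′ k)) }
          ; ∙-cong = λ {p} {p′} {q} {q′} e e′ → ≈-intro λ k → begin
              coeff (mulP p q) k    ≡⟨ coeff-mulP p q k ⟩
              act p (coeff q) k     ≡⟨ act-cong p (coeffs e′) k ⟩
              act p (coeff q′) k    ≡⟨ act-coeff p p′ (coeffs e) _ k ⟩
              act p′ (coeff q′) k   ≡⟨ coeff-mulP p′ q′ k ⟨
              coeff (mulP p′ q′) k  ∎ }
        ; assoc = λ p q s → ≈-intro λ k → begin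
            coeff (mulP (mulP p q) s) k   ≡⟨ coeff-mulP (mulP p q) s k ⟩
            act (mulP p q) (coeff s) k    ≡⟨ act-mulP p q _ k ⟩
            act p (act q (coeff s)) k     ≡⟨ act-cong p (coeff-mulP q s) k ⟨
            act p (coeff (mulP q s)) k    ≡⟨ coeff-mulP p (mulP q s) k ⟨
            coeff (mulP p (mulP q s)) k   ∎ }
      ; identity = (λ p → ≈-intro λ k → trans (coeff-mulP oneP p k) (oneP-act (coeff p) k))
                 , (λ p → ≈-intro λ k → trans (coeff-mulP p oneP k) (act-oneP p k)) }
    ; comm = λ p q → ≈-intro λ k → begin
        coeff (mulP p q) k               ≡⟨ coeff-mulP p q k ⟩
        act p (coeff q) k                ≡⟨ act-cong p (act-oneP q) k ⟨
        act p (act q (coeff oneP)) k     ≡⟨ act-comm p q _ k ⟩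
        act q (act p (coeff oneP)) k     ≡⟨ act-cong q (act-oneP p) k ⟩
        act q (coeff p) k                ≡⟨ coeff-mulP q p k ⟨
        coeff (mulP q p) k               ∎ } }
  where open ≡-Reasoning

-- Multiplication by x^n, x^n - 1 and geometric sums

S : ℕ → Seq → Seq
S zero    f = f
S (suc n) f = shift (S n f)

S-cong : ∀ n {f g} → f ≗ g → S n f ≗ S n g
S-cong zero    f≗g = f≗g
S-cong (suc n) f≗g = shift-cong (S-cong n f≗g)

S-linear : ∀ n a f g → S n (λ k → a ℤ.* f k ℤ.+ g k) ≗ (λ k → a ℤ.* S n f k ℤ.+ S n g k)
S-linear zero    a f g k = refl
S-linear (suc n) a f g k = trans (shift-cong (S-linear n a f g) k) (shift-linear a (S n f) (S n g) k)

S-zero : ∀ n k → S n (λ _ → + 0) k ≡ + 0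
S-zero zero    k = refl
S-zero (suc n) k = trans (shift-cong (S-zero n) k) (shift-zero k)

S-+ : ∀ m n f → S (m + n) f ≗ S m (S n f)
S-+ zero    n f k = refl
S-+ (suc m) n f k = shift-cong (S-+ m n f) k

act-S : ∀ p n f → act p (S n f) ≗ S n (act p f)
act-S p zero    f k = refl
act-S p (suc n) f k = trans (act-shift p (S n f) k) (shift-cong (act-S p n f) k)

S-below : ∀ n f {k} → k < n → S n f k ≡ + 0
S-below (suc n) f {zero}  k<n       = refl
S-below (suc n) f {suc k} (s≤s k<n) = S-below n f k<n

S-above : ∀ n f k → S n f (n + k) ≡ f k
S-above zero    f k = refl
S-above (suc n) f k = S-above n f k

coeff-++ : ∀ p q → coeff (p ++ q) ≗ (λ k → coeff p k ℤ.+ S (length p) (coeff q) k)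
coeff-++ []      q k       = sym (ℤ.+-identityˡ _)
coeff-++ (a ∷ p) q zero    = sym (ℤ.+-identityʳ a)
coeff-++ (a ∷ p) q (suc k) = coeff-++ p q k

coeff-beyond : ∀ p {k} → length p ≤ k → coeff p k ≡ + 0
coeff-beyond []      _       = refl
coeff-beyond (a ∷ p) (s≤s l) = coeff-beyond p l

act-xnMinus1 : ∀ n f → act (xnMinus1 n) f ≗ (λ k → S n f k ℤ.- f k)
act-xnMinus1 zero    f k = sym (ℤ.+-inverseʳ (f k))
act-xnMinus1 (suc n) f k = begin
  ℤ.-1ℤ ℤ.* f k ℤ.+ shift (act (replicate n (+ 0) ++ oneP) f) k
    ≡⟨ cong (ℤ._+_ (ℤ.-1ℤ ℤ.* f k)) (shift-cong (monomial n) k) ⟩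
  ℤ.-1ℤ ℤ.* f k ℤ.+ shift (S n f) k
    ≡⟨ swap (f k) _ ⟩
  shift (S n f) k ℤ.- f k ∎
  where
  open ≡-Reasoning
  swap : ∀ x y → ℤ.-1ℤ ℤ.* x ℤ.+ y ≡ y ℤ.- x
  swap = solve-∀
  monomial : ∀ n → act (replicate n (+ 0) ++ oneP) f ≗ S n f
  monomial zero    j = oneP-act f j
  monomial (suc n) j = trans (ℤ.+-identityˡ _) (shift-cong (monomial n) j)

-- U n s multiplies by 1 + x^s + ⋯ + x^((n-1)s).
U : ℕ → ℕ → Seq → Seq
U zero    s f k = + 0
U (suc n) s f k = f k ℤ.+ S s (U n s f) k

act-U : ∀ p n s f → act p (U n s f) ≗ U n s (act p f)
act-U p zero    s f k = act-zero p k
act-U p (suc n) s f k = begin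
  act p (U (suc n) s f) k
    ≡⟨ act-cong p (λ j → cong (ℤ._+ S s (U n s f) j) (sym (ℤ.*-identityˡ (f j)))) k ⟩
  act p (λ j → + 1 ℤ.* f j ℤ.+ S s (U n s f) j) k
    ≡⟨ act-linear p (+ 1) f (S s (U n s f)) k ⟩
  + 1 ℤ.* act p f k ℤ.+ act p (S s (U n s f)) k
    ≡⟨ cong₂ ℤ._+_ (ℤ.*-identityˡ (act p f k)) (trans (act-S p s _ k) (S-cong s (act-U p n s f) k)) ⟩
  act p f k ℤ.+ S s (U n s (act p f)) k ∎
  where open ≡-Reasoning

act-xnMinus1-U : ∀ n s f → act (xnMinus1 s) (U n s f) ≗ act (xnMinus1 (n * s)) f
act-xnMinus1-U zero    s f k = act-zero (xnMinus1 s) k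
act-xnMinus1-U (suc n) s f k = begin
  act X (λ j → f j ℤ.+ S s (U n s f) j) k
    ≡⟨ act-cong X (λ j → cong (ℤ._+ S s (U n s f) j) (sym (ℤ.*-identityˡ (f j)))) k ⟩
  act X (λ j → + 1 ℤ.* f j ℤ.+ S s (U n s f) j) k
    ≡⟨ act-linear X (+ 1) f (S s (U n s f)) k ⟩
  + 1 ℤ.* act X f k ℤ.+ act X (S s (U n s f)) k
    ≡⟨ cong₂ (λ x y → + 1 ℤ.* x ℤ.+ y) (act-xnMinus1 s f k) (begin
         act X (S s (U n s f)) k           ≡⟨ act-S X s (U n s f) k ⟩
         S s (act X (U n s f)) k           ≡⟨ S-cong s (act-xnMinus1-U n s f) k ⟩
         S s (act (xnMinus1 (n * s)) f) k  ≡⟨ act-S (xnMinus1 (n * s)) s f k ⟨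
         act (xnMinus1 (n * s)) (S s f) k  ≡⟨ act-xnMinus1 (n * s) (S s f) k ⟩
         S (n * s) (S s f) k ℤ.- S s f k   ∎) ⟩
  + 1 ℤ.* (S s f k ℤ.- f k) ℤ.+ (S (n * s) (S s f) k ℤ.- S s f k)
    ≡⟨ telescope (S s f k) (f k) (S (n * s) (S s f) k) ⟩
  S (n * s) (S s f) k ℤ.- f k
    ≡⟨ cong (ℤ._- f k) (S-+ (n * s) s f k) ⟨
  S (n * s + s) f k ℤ.- f k
    ≡⟨ cong (λ m → S m f k ℤ.- f k) (ℕ.+-comm (n * s) s) ⟩
  S (s + n * s) f k ℤ.- f k
    ≡⟨ act-xnMinus1 (suc n * s) f k ⟨
  act (xnMinus1 (suc n * s)) f k ∎
  where
  open ≡-Reasoning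
  X = xnMinus1 s
  telescope : ∀ x y z → + 1 ℤ.* (x ℤ.- y) ℤ.+ (z ℤ.- x) ≡ z ℤ.- y
  telescope = solve-∀

-- The constant term -1 makes x^n - 1 invertible as a power series: the coefficient at k is
-- determined by the product at k and the coefficient at k - n. This is the cancellation law of the
-- proof.
act-xnMinus1-injective : ∀ n → 0 < n → ∀ f g →
  act (xnMinus1 n) f ≗ act (xnMinus1 n) g → f ≗ g
act-xnMinus1-injective n 0<n f g eq k = go (suc k) k ℕ.≤-refl
  where
  open ≡-Reasoning
  diff : ∀ x y → x ≡ y ℤ.- (y ℤ.- x)
  diff = solve-∀
  solve : ∀ k → f k ≡ S n f k ℤ.- act (xnMinus1 n) f k
  solve k = trans (diff (f k) (S n f k)) (cong (ℤ._-_ (S n f k)) (sym (act-xnMinus1 n f k)))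
  solve′ : ∀ k → g k ≡ S n g k ℤ.- act (xnMinus1 n) g k
  solve′ k = trans (diff (g k) (S n g k)) (cong (ℤ._-_ (S n g k)) (sym (act-xnMinus1 n g k)))
  S-agree : ∀ k → (∀ j → j < k → f j ≡ g j) → S n f k ≡ S n g k
  S-agree k agree with ℕ.<-≤-connex k n
  ... | inj₁ k<n = trans (S-below n f k<n) (sym (S-below n g k<n))
  ... | inj₂ n≤k = begin
    S n f k               ≡⟨ cong (S n f) k≡ ⟩
    S n f (n + (k ∸ n))   ≡⟨ S-above n f _ ⟩
    f (k ∸ n)             ≡⟨ agree _ (ℕ.∸-monoʳ-< {k} {n} {0} 0<n n≤k) ⟩
    g (k ∸ n)             ≡⟨ S-above n g _ ⟨
    S n g (n + (k ∸ n))   ≡⟨ cong (S n g) k≡ ⟨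
    S n g k               ∎
    where k≡ = sym (ℕ.m+[n∸m]≡n n≤k)
  go : ∀ b k → k < b → f k ≡ g k
  go (suc b) k (s≤s k≤b) = begin
    f k                                  ≡⟨ solve k ⟩
    S n f k ℤ.- act (xnMinus1 n) f k
      ≡⟨ cong₂ ℤ._-_ (S-agree k (λ j j<k → go b j (ℕ.<-≤-trans j<k k≤b))) (eq k) ⟩
    S n g k ℤ.- act (xnMinus1 n) g k     ≡⟨ solve′ k ⟨
    g k                                  ∎

-- Monic polynomials and degrees

data Monic : Poly → Set where
  one : Monic oneP
  _∷_ : ∀ a {p} → Monic p → Monic (a ∷ p)

Monic-++ : ∀ p → Monic (p ++ oneP)
Monic-++ []      = one
Monic-++ (a ∷ p) = a ∷ Monic-++ p

Monic-init : ∀ {p} → Monic p → ∃[ p′ ] p ≡ p′ ++ oneP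
Monic-init one     = [] , refl
Monic-init (a ∷ m) with Monic-init m
... | p′ , refl = a ∷ p′ , refl

Monic-addP : ∀ p {q} → Monic q → length p < length q → Monic (addP p q)
Monic-addP []          m       l       = m
Monic-addP (a ∷ p)     (b ∷ m) (s≤s l) = (a ℤ.+ b) ∷ Monic-addP p m l
Monic-addP (a ∷ [])    one     (s≤s ())
Monic-addP (a ∷ b ∷ p) one     (s≤s ())

map-1* : ∀ p → map (+ 1 ℤ.*_) p ≡ p
map-1* []      = refl
map-1* (a ∷ p) = cong₂ _∷_ (ℤ.*-identityˡ a) (map-1* p)

length-addP : ∀ p q → length q ≤ length (addP p q)
length-addP []      q       = ℕ.≤-refl
length-addP (a ∷ p) []      = z≤n
length-addP (a ∷ p) (b ∷ q) = s≤s (length-addP p q)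

length-mulP : ∀ {p} → Monic p → ∀ q → length q ≤ length (mulP p q)
length-mulP one     []      = z≤n
length-mulP one     (b ∷ q) = s≤s (ℕ.≤-reflexive (sym (trans (cong length (addP-[] (map (+ 1 ℤ.*_) q))) (length-map (+ 1 ℤ.*_) q))))
  where
  addP-[] : ∀ p → addP p [] ≡ p
  addP-[] []      = refl
  addP-[] (a ∷ p) = refl
length-mulP (_∷_ a {p} m) q = ℕ.≤-trans (ℕ.≤-trans (length-mulP m q) (ℕ.n≤1+n _))
  (length-addP (map (a ℤ.*_) q) (+ 0 ∷ mulP p q))

Monic-mulP : ∀ {p q} → Monic p → Monic q → Monic (mulP p q)
Monic-mulP {q = q} one m = subst Monic (sym (oneP-mulP m)) m
  where
  oneP-mulP : ∀ {q} → Monic q → mulP oneP q ≡ q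
  oneP-mulP one             = refl
  oneP-mulP (_∷_ a {p} m)   with map (+ 1 ℤ.*_) p | map-1* p
  oneP-mulP (_∷_ a {_ ∷ _} m) | _ | refl = cong (_∷ _) (trans (ℤ.+-identityʳ _) (ℤ.*-identityˡ a))
  oneP-mulP (_∷_ a {[]} ())   | _ | refl
Monic-mulP {q = q} (_∷_ a {p} m) m′ = Monic-addP (map (a ℤ.*_) q) (+ 0 ∷ Monic-mulP m m′)
  (s≤s (ℕ.≤-trans (ℕ.≤-reflexive (length-map (a ℤ.*_) q)) (length-mulP m q)))

-- Every term except the leading one meets f above N, where it vanishes, so the top coefficient of f
-- survives in the product.
act-top : ∀ {p d} → Monic p → length p ≡ suc d → ∀ f N → (∀ k → N < k → f k ≡ + 0) →
  act p f (d + N) ≡ f N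
act-top one refl f N f≗0 = oneP-act f N
act-top {d = zero}  (a ∷ one)     ()
act-top {d = zero}  (a ∷ (_ ∷ _)) ()
act-top {d = suc d} (_∷_ a {p} m) eq f N f≗0 = begin
  a ℤ.* f (suc (d + N)) ℤ.+ act p f (d + N)
    ≡⟨ cong₂ ℤ._+_ (trans (cong (a ℤ.*_) (f≗0 _ (s≤s (ℕ.m≤n+m N d)))) (ℤ.*-zeroʳ a))
                   (act-top m (ℕ.suc-injective eq) f N f≗0) ⟩
  + 0 ℤ.+ f N ≡⟨ ℤ.+-identityˡ _ ⟩
  f N ∎
  where open ≡-Reasoning

-- The top coefficient of f reappears in the product at degree d or above, hence is zero; lowering N
-- one step at a time ends at f = 0. Finite support is essential: 1/(x - 1) times x - 1 is 1.
act-degree : ∀ {p d} → Monic p → length p ≡ suc d → ∀ f N → (∀ k → N ≤ k → f k ≡ + 0) →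
  (∀ k → d ≤ k → act p f k ≡ + 0) → ∀ k → f k ≡ + 0
act-degree m eq f zero    f≗0 low k = f≗0 k z≤n
act-degree m eq f (suc N) f≗0 low   = act-degree m eq f N vanish low
  where
  vanish : ∀ k → N ≤ k → f k ≡ + 0
  vanish k N≤k with ℕ.m≤n⇒m<n∨m≡n N≤k
  ... | inj₁ N<k  = f≗0 k N<k
  ... | inj₂ refl = trans (sym (act-top m eq f N f≗0)) (low _ (ℕ.m≤m+n _ N))

-- Lists with the highest degree first

coeffHF : List ℤ → Seq
coeffHF as = coeff (reverse as)

coeffHF-∷ : ∀ c as → coeffHF (c ∷ as) ≗ (λ k → c ℤ.* S (length as) (coeff oneP) k ℤ.+ coeffHF as k)
coeffHF-∷ c as k = begin
  coeff (reverse (c ∷ as)) k              ≡⟨ cong (λ l → coeff l k) (unfold-reverse c as) ⟩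
  coeff (reverse as ++ (c ∷ [])) k        ≡⟨ coeff-++ (reverse as) (c ∷ []) k ⟩
  coeffHF as k ℤ.+ S (length (reverse as)) (coeff (c ∷ [])) k
    ≡⟨ ℤ.+-comm (coeffHF as k) _ ⟩
  S (length (reverse as)) (coeff (c ∷ [])) k ℤ.+ coeffHF as k
    ≡⟨ cong (λ n → S n (coeff (c ∷ [])) k ℤ.+ coeffHF as k) (length-reverse as) ⟩
  S n (coeff (c ∷ [])) k ℤ.+ coeffHF as k
    ≡⟨ cong (ℤ._+ coeffHF as k) (S-cong n constant k) ⟩
  S n (λ j → c ℤ.* coeff oneP j ℤ.+ + 0) k ℤ.+ coeffHF as k
    ≡⟨ cong (ℤ._+ coeffHF as k) (S-linear n c (coeff oneP) (λ _ → + 0) k) ⟩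
  c ℤ.* S n (coeff oneP) k ℤ.+ S n (λ _ → + 0) k ℤ.+ coeffHF as k
    ≡⟨ cong (λ z → c ℤ.* S n (coeff oneP) k ℤ.+ z ℤ.+ coeffHF as k) (S-zero n k) ⟩
  c ℤ.* S n (coeff oneP) k ℤ.+ + 0 ℤ.+ coeffHF as k
    ≡⟨ cong (ℤ._+ coeffHF as k) (ℤ.+-identityʳ (c ℤ.* S n (coeff oneP) k)) ⟩
  c ℤ.* S n (coeff oneP) k ℤ.+ coeffHF as k ∎
  where
  open ≡-Reasoning
  n = length as
  constant : coeff (c ∷ []) ≗ (λ j → c ℤ.* coeff oneP j ℤ.+ + 0)
  constant zero    = sym (trans (ℤ.+-identityʳ _) (ℤ.*-identityʳ c))
  constant (suc j) = sym (trans (ℤ.+-identityʳ _) (ℤ.*-zeroʳ c))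

length-subHF : ∀ n as bs → length as ≡ n + length bs → length (subHF as bs) ≡ length as
length-subHF n []       []       eq = refl
length-subHF n (a ∷ as) []       eq = refl
length-subHF n []       (b ∷ bs) eq = contradiction (trans eq (ℕ.+-suc n _)) λ ()
length-subHF n (a ∷ as) (b ∷ bs) eq =
  cong suc (length-subHF n as bs (ℕ.suc-injective (trans eq (ℕ.+-suc n _))))

-- Aligning `bs` with the front of `as` aligns the top degrees, so what is subtracted is x^n times
-- `bs`, with n the difference of the lengths.
coeffHF-subHF : ∀ n as bs → length as ≡ n + length bs →
  coeffHF (subHF as bs) ≗ (λ k → ℤ.-1ℤ ℤ.* S n (coeffHF bs) k ℤ.+ coeffHF as k)
coeffHF-subHF n []       []       eq k =
  sym (trans (ℤ.+-identityʳ _) (cong (ℤ.-1ℤ ℤ.*_) (S-zero n k)))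
coeffHF-subHF n (a ∷ as) []       eq k =
  sym (trans (cong (λ z → ℤ.-1ℤ ℤ.* z ℤ.+ coeffHF (a ∷ as) k) (S-zero n k)) (ℤ.+-identityˡ _))
coeffHF-subHF n []       (b ∷ bs) eq = contradiction (trans eq (ℕ.+-suc n _)) λ ()
coeffHF-subHF n (a ∷ as) (b ∷ bs) eq k = begin
  coeffHF ((a ℤ.- b) ∷ subHF as bs) k
    ≡⟨ coeffHF-∷ (a ℤ.- b) (subHF as bs) k ⟩
  (a ℤ.- b) ℤ.* S (length (subHF as bs)) δ k ℤ.+ coeffHF (subHF as bs) k
    ≡⟨ cong₂ (λ l z → (a ℤ.- b) ℤ.* S l δ k ℤ.+ z) (length-subHF n as bs eq′)
             (coeffHF-subHF n as bs eq′ k) ⟩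
  (a ℤ.- b) ℤ.* S (length as) δ k ℤ.+ (ℤ.-1ℤ ℤ.* S n (coeffHF bs) k ℤ.+ coeffHF as k)
    ≡⟨ rearrange a b _ (S n (coeffHF bs) k) (coeffHF as k) ⟩
  ℤ.-1ℤ ℤ.* (b ℤ.* S (length as) δ k ℤ.+ S n (coeffHF bs) k) ℤ.+ (a ℤ.* S (length as) δ k ℤ.+ coeffHF as k)
    ≡⟨ cong₂ (λ x y → ℤ.-1ℤ ℤ.* x ℤ.+ y) (begin
         b ℤ.* S (length as) δ k ℤ.+ S n (coeffHF bs) k
           ≡⟨ cong (λ l → b ℤ.* S l δ k ℤ.+ S n (coeffHF bs) k) eq′ ⟩
         b ℤ.* S (n + length bs) δ k ℤ.+ S n (coeffHF bs) k
           ≡⟨ cong (λ z → b ℤ.* z ℤ.+ S n (coeffHF bs) k) (S-+ n (length bs) δ k) ⟩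
         b ℤ.* S n (S (length bs) δ) k ℤ.+ S n (coeffHF bs) k
           ≡⟨ S-linear n b (S (length bs) δ) (coeffHF bs) k ⟨
         S n (λ j → b ℤ.* S (length bs) δ j ℤ.+ coeffHF bs j) k
           ≡⟨ S-cong n (coeffHF-∷ b bs) k ⟨
         S n (coeffHF (b ∷ bs)) k ∎) (sym (coeffHF-∷ a as k)) ⟩
  ℤ.-1ℤ ℤ.* S n (coeffHF (b ∷ bs)) k ℤ.+ coeffHF (a ∷ as) k ∎
  where
  open ≡-Reasoning
  δ = coeff oneP
  eq′ = ℕ.suc-injective (trans eq (ℕ.+-suc n _))
  rearrange : ∀ a b x y z → (a ℤ.- b) ℤ.* x ℤ.+ (ℤ.-1ℤ ℤ.* y ℤ.+ z) ≡
    ℤ.-1ℤ ℤ.* (b ℤ.* x ℤ.+ y) ℤ.+ (a ℤ.* x ℤ.+ z)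
  rearrange = solve-∀

coeffHF-map : ∀ c as → coeffHF (map (c ℤ.*_) as) ≗ (λ k → c ℤ.* coeffHF as k)
coeffHF-map c as k = trans (cong (λ l → coeff l k) (sym (reverse-map (c ℤ.*_) as)))
  (coeff-map c (reverse as) k)

-- Long division and cyclotomic polynomials

-- Every step of the long division clears one leading coefficient, so dividend and
-- divisor times quotient agree in all degrees not below that of the divisor.
quotHF-correct : ∀ f bt as → length as ≤ f →
  length (quotHF f bt as) ≡ length as ∸ length bt ×
  (∀ k → length bt ≤ k → coeffHF as k ≡ act (reverse (+ 1 ∷ bt)) (coeffHF (quotHF f bt as)) k)
quotHF-correct zero    bt []       l = sym (ℕ.0∸n≡0 (length bt)) , λ k _ → sym (act-zero (reverse (+ 1 ∷ bt)) k)
quotHF-correct (suc f) bt []       l = sym (ℕ.0∸n≡0 (length bt)) , λ k _ → sym (act-zero (reverse (+ 1 ∷ bt)) k)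
quotHF-correct (suc f) bt (c ∷ as) (s≤s l) with length as <ᵇ length bt in eq
... | true  = sym (ℕ.m≤n⇒m∸n≡0 as<bt) , λ k bt≤k → trans
        (coeff-beyond (reverse (c ∷ as))
          (ℕ.≤-trans (ℕ.≤-reflexive (length-reverse (c ∷ as))) (ℕ.≤-trans as<bt bt≤k)))
        (sym (act-zero (reverse (+ 1 ∷ bt)) k))
  where
  as<bt : length as < length bt
  as<bt = ℕ.<ᵇ⇒< (length as) (length bt) (subst T (sym eq) tt)
... | false = trans (cong suc lengthQ) (sym (ℕ.+-∸-assoc 1 bt≤as)) , agree
  where
  open ≡-Reasoning
  δ = coeff oneP
  bs = map (c ℤ.*_) bt
  b = reverse (+ 1 ∷ bt)
  bt≤as : length bt ≤ length as
  bt≤as = ℕ.≮⇒≥ λ as<bt → subst T eq (ℕ.<⇒<ᵇ as<bt)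
  n = length as ∸ length bt
  split : length as ≡ n + length bs
  split = trans (sym (ℕ.m∸n+n≡m bt≤as)) (cong (_+_ n) (sym (length-map (c ℤ.*_) bt)))
  as′ = subHF as bs
  len′ : length as′ ≡ length as
  len′ = length-subHF n as bs split
  ih = quotHF-correct f bt as′ (ℕ.≤-trans (ℕ.≤-reflexive len′) l)
  Q = quotHF f bt as′
  lengthQ : length Q ≡ n
  lengthQ = trans (proj₁ ih) (cong (_∸ length bt) len′)
  -- The divisor times x^n, split into the leading term, which cancels the head c of the dividend,
  -- and the remainder, which c times over is what `bs` subtracts.
  shifted-divisor : act b (S (length Q) δ) ≗ (λ k → S (length as) δ k ℤ.+ S n (coeffHF bt) k)
  shifted-divisor k = begin
    act b (S (length Q) δ) k   ≡⟨ act-S b (length Q) δ k ⟩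
    S (length Q) (act b δ) k   ≡⟨ cong (λ m → S m (act b δ) k) lengthQ ⟩
    S n (act b δ) k            ≡⟨ S-cong n (act-oneP b) k ⟩
    S n (coeffHF (+ 1 ∷ bt)) k ≡⟨ S-cong n (coeffHF-∷ (+ 1) bt) k ⟩
    S n (λ j → + 1 ℤ.* S (length bt) δ j ℤ.+ coeffHF bt j) k
      ≡⟨ S-linear n (+ 1) (S (length bt) δ) (coeffHF bt) k ⟩
    + 1 ℤ.* S n (S (length bt) δ) k ℤ.+ S n (coeffHF bt) k
      ≡⟨ cong (ℤ._+ S n (coeffHF bt) k) (trans (ℤ.*-identityˡ _) (sym (S-+ n (length bt) δ k))) ⟩
    S (n + length bt) δ k ℤ.+ S n (coeffHF bt) k
      ≡⟨ cong (λ m → S m δ k ℤ.+ S n (coeffHF bt) k) (ℕ.m∸n+n≡m bt≤as) ⟩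
    S (length as) δ k ℤ.+ S n (coeffHF bt) k ∎
  S-scaled : S n (coeffHF bs) ≗ (λ k → c ℤ.* S n (coeffHF bt) k)
  S-scaled k = begin
    S n (coeffHF bs) k
      ≡⟨ S-cong n (λ j → trans (coeffHF-map c bt j) (sym (ℤ.+-identityʳ _))) k ⟩
    S n (λ j → c ℤ.* coeffHF bt j ℤ.+ + 0) k
      ≡⟨ S-linear n c (coeffHF bt) (λ _ → + 0) k ⟩
    c ℤ.* S n (coeffHF bt) k ℤ.+ S n (λ _ → + 0) k
      ≡⟨ trans (cong (ℤ._+_ (c ℤ.* S n (coeffHF bt) k)) (S-zero n k)) (ℤ.+-identityʳ _) ⟩
    c ℤ.* S n (coeffHF bt) k ∎
  rearrange : ∀ c x y z → c ℤ.* x ℤ.+ z ≡ c ℤ.* (x ℤ.+ y) ℤ.+ (ℤ.-1ℤ ℤ.* (c ℤ.* y) ℤ.+ z)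
  rearrange = solve-∀
  agree : ∀ k → length bt ≤ k → coeffHF (c ∷ as) k ≡ act b (coeffHF (c ∷ Q)) k
  agree k bt≤k = begin
    coeffHF (c ∷ as) k                           ≡⟨ coeffHF-∷ c as k ⟩
    c ℤ.* S (length as) δ k ℤ.+ coeffHF as k     ≡⟨ rearrange c _ (S n (coeffHF bt) k) _ ⟩
    c ℤ.* (S (length as) δ k ℤ.+ S n (coeffHF bt) k) ℤ.+
      (ℤ.-1ℤ ℤ.* (c ℤ.* S n (coeffHF bt) k) ℤ.+ coeffHF as k)
      ≡⟨ cong₂ (λ x y → c ℤ.* x ℤ.+ (ℤ.-1ℤ ℤ.* y ℤ.+ coeffHF as k))
           (sym (shifted-divisor k)) (sym (S-scaled k)) ⟩
    c ℤ.* act b (S (length Q) δ) k ℤ.+ (ℤ.-1ℤ ℤ.* S n (coeffHF bs) k ℤ.+ coeffHF as k)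
      ≡⟨ cong (ℤ._+_ (c ℤ.* act b (S (length Q) δ) k))
           (trans (sym (coeffHF-subHF n as bs split k)) (proj₂ ih k bt≤k)) ⟩
    c ℤ.* act b (S (length Q) δ) k ℤ.+ act b (coeffHF Q) k
      ≡⟨ act-linear b c (S (length Q) δ) (coeffHF Q) k ⟨
    act b (λ j → c ℤ.* S (length Q) δ j ℤ.+ coeffHF Q j) k
      ≡⟨ act-cong b (coeffHF-∷ c Q) k ⟨
    act b (coeffHF (c ∷ Q)) k ∎

divMonic-≡ : ∀ a b {x bt} → reverse b ≡ x ∷ bt →
  divMonic a b ≡ reverse (quotHF (length a) bt (reverse a))
divMonic-≡ a b eq with reverse b | eq
... | _ | refl = refl

reverse-Monic : ∀ {b} → Monic b → ∃[ bt ] reverse b ≡ + 1 ∷ bt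
reverse-Monic m with Monic-init m
... | b′ , refl = reverse b′ , reverse-++ b′ oneP

-- The computed quotient q and h, both multiplied by b, agree from degree deg b on, so b(q - h) has
-- degree below deg b and `act-degree` forces q = h.
divMonic-exact : ∀ a {b} → Monic b → ∀ h N → (∀ k → N ≤ k → h k ≡ + 0) →
  act b h ≗ coeff a → coeff (divMonic a b) ≗ h
divMonic-exact a {b} m h N h≗0 exact k = begin
  coeff (divMonic a b) k      ≡⟨ cong (λ l → coeff l k) (divMonic-≡ a b rev) ⟩
  q k                         ≡⟨ undo (h k) (q k) ⟩
  h k ℤ.+ (ℤ.-1ℤ ℤ.* h k ℤ.+ q k)
    ≡⟨ cong (ℤ._+_ (h k)) (act-degree m len e (N + length (reverse Q)) support low k) ⟩
  h k ℤ.+ + 0                 ≡⟨ ℤ.+-identityʳ _ ⟩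
  h k                         ∎
  where
  open ≡-Reasoning
  bt = proj₁ (reverse-Monic m)
  rev = proj₂ (reverse-Monic m)
  Q = quotHF (length a) bt (reverse a)
  q = coeffHF Q
  e : Seq
  e k = ℤ.-1ℤ ℤ.* h k ℤ.+ q k
  b≡ : reverse (+ 1 ∷ bt) ≡ b
  b≡ = trans (cong reverse (sym rev)) (reverse-involutive b)
  len : length b ≡ suc (length bt)
  len = trans (sym (length-reverse b)) (cong length rev)
  undo : ∀ x y → y ≡ x ℤ.+ (ℤ.-1ℤ ℤ.* x ℤ.+ y)
  undo = solve-∀
  support : ∀ k → N + length (reverse Q) ≤ k → e k ≡ + 0
  support k l = cong₂ (λ x y → ℤ.-1ℤ ℤ.* x ℤ.+ y) (h≗0 k (ℕ.m+n≤o⇒m≤o N l))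
    (coeff-beyond (reverse Q) (ℕ.m+n≤o⇒n≤o N l))
  low : ∀ k → length bt ≤ k → act b e k ≡ + 0
  low k bt≤k = begin
    act b e k                                ≡⟨ act-linear b ℤ.-1ℤ h q k ⟩
    ℤ.-1ℤ ℤ.* act b h k ℤ.+ act b q k        ≡⟨ cong₂ (λ x y → ℤ.-1ℤ ℤ.* x ℤ.+ y) (exact k) (begin
      act b q k                     ≡⟨ cong (λ l → act l q k) b≡ ⟨
      act (reverse (+ 1 ∷ bt)) q k
        ≡⟨ proj₂ (quotHF-correct (length a) bt (reverse a) (ℕ.≤-reflexive (length-reverse a))) k bt≤k ⟨
      coeff (reverse (reverse a)) k ≡⟨ cong (λ l → coeff l k) (reverse-involutive a) ⟩
      coeff a k                     ∎) ⟩
    ℤ.-1ℤ ℤ.* coeff a k ℤ.+ coeff a k        ≡⟨ cancel (coeff a k) ⟩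
    + 0                                      ∎
    where
    cancel : ∀ x → ℤ.-1ℤ ℤ.* x ℤ.+ x ≡ + 0
    cancel = solve-∀

-- The first quotient entry is the leading 1 of the dividend. The quotient cannot be empty: then h =
-- 0, while the constant term of the dividend is -1.
Monic-divMonic : ∀ n {b} → Monic b → ∀ h N → (∀ k → N ≤ k → h k ≡ + 0) →
  act b h ≗ coeff (xnMinus1 (suc n)) → Monic (divMonic (xnMinus1 (suc n)) b)
Monic-divMonic n {b} m h N h≗0 exact =
  subst Monic (sym D≡) (leading (length x) (reverse x) revx λ Q≡ → contradiction (nonzero Q≡) λ ())
  where
  open ≡-Reasoning
  x = xnMinus1 (suc n)
  bt = proj₁ (reverse-Monic m)
  Q = quotHF (length x) bt (reverse x)
  D≡ : divMonic x b ≡ reverse Q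
  D≡ = divMonic-≡ x b (proj₂ (reverse-Monic m))
  revx : ∃[ as ] reverse x ≡ + 1 ∷ as
  revx = _ , reverse-++ (ℤ.-1ℤ ∷ replicate n (+ 0)) oneP
  nonzero : Q ≡ [] → + 0 ≡ ℤ.-1ℤ
  nonzero Q≡ = begin
    + 0                   ≡⟨ act-zero b 0 ⟨
    act b (λ _ → + 0) 0   ≡⟨ act-cong b (λ k → trans (cong (λ l → coeff (reverse l) k) (sym Q≡))
                                (trans (cong (λ l → coeff l k) (sym D≡))
                                  (divMonic-exact x m h N h≗0 exact k))) 0 ⟩
    act b h 0             ≡⟨ exact 0 ⟩
    ℤ.-1ℤ                 ∎
  leading : ∀ f as → ∃[ as′ ] as ≡ + 1 ∷ as′ → ¬ quotHF f bt as ≡ [] → Monic (reverse (quotHF f bt as))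
  leading zero    _ _            Q≢[] = contradiction refl Q≢[]
  leading (suc f) _ (as , refl)  Q≢[] with length as <ᵇ length bt
  ... | true  = contradiction refl Q≢[]
  ... | false = subst Monic (sym (unfold-reverse (+ 1) Q′)) (Monic-++ (reverse Q′))
    where Q′ = quotHF f bt (subHF as (map (+ 1 ℤ.*_) bt))

-- Products of cyclotomic polynomials over divisor lists

Φ : ℕ → Poly
Φ n = divMonic (xnMinus1 n) (Psi n)

-- `Psi n` uses table entries below n only, so `Φ n` is by definition the entry appended at step n.
cyclotomicTable-≡ : ∀ n → cyclotomicTable n ≡ applyUpTo (λ i → Φ (suc i)) n
cyclotomicTable-≡ zero    = refl
cyclotomicTable-≡ (suc n) = trans (cong (_++ (Φ (suc n) ∷ [])) (cyclotomicTable-≡ n))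
  (applyUpTo-∷ʳ (λ i → Φ (suc i)) n)

ΠΦ : List ℕ → Poly
ΠΦ = foldr (λ d → mulP (Φ d)) oneP

least-∈ : ∀ {d ds} → AllPairs _<_ ds → (∀ {e} → e ∈ ds → d ≤ e) → d ∈ ds → ∃[ ds′ ] ds ≡ d ∷ ds′
least-∈ asc         d≤ (here refl) = _ , refl
least-∈ (x<ds ∷ _) d≤ (there d∈)  = contradiction (d≤ (here refl)) (ℕ.<⇒≱ (All.lookup x<ds d∈))

-- The scan meets the divisors in increasing order, so for an ascending list of the divisors in the
-- window from d to d + m the two products have the same factors in the same order and are equal as
-- lists.
prodDivisors-≡ : ∀ n m d f ds → (∀ i → f i ≡ Φ (d + i)) → AllPairs _<_ ds →
  (∀ {e} → e ∈ ds → d ≤ e × e < d + m × e ∣ n) →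
  (∀ {e} → d ≤ e → e < d + m → e ∣ n → e ∈ ds) →
  prodDivisors n d (applyUpTo f m) ≡ ΠΦ ds
prodDivisors-≡ n zero d f []       f≡ asc sound complete = refl
prodDivisors-≡ n zero d f (e ∷ ds) f≡ asc sound complete with sound (here refl)
... | d≤e , e<d+0 , _ = contradiction d≤e (ℕ.<⇒≱ (subst (e <_) (ℕ.+-identityʳ d) e<d+0))
prodDivisors-≡ n (suc m) d f ds f≡ asc sound complete with d ∣? n
... | no  d∤n = prodDivisors-≡ n m (suc d) _ ds (λ i → trans (f≡ (suc i)) (cong Φ (ℕ.+-suc d i))) asc
    (λ {e} e∈ → let d≤e , e< , e∣n = sound e∈ in
       ℕ.≤∧≢⇒< d≤e (λ { refl → d∤n e∣n }) , subst (e <_) (ℕ.+-suc d m) e< , e∣n)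
    (λ {e} d<e e< → complete (ℕ.<⇒≤ d<e) (subst (e <_) (sym (ℕ.+-suc d m)) e<))
... | yes d∣n with least-∈ asc (λ e∈ → proj₁ (sound e∈)) (complete ℕ.≤-refl (ℕ.m<m+n d (s≤s z≤n)) d∣n) | asc
...   | ds′ , refl | d<ds′ ∷ asc′ =
    cong₂ mulP (trans (f≡ 0) (cong Φ (ℕ.+-identityʳ d)))
      (prodDivisors-≡ n m (suc d) _ ds′ (λ i → trans (f≡ (suc i)) (cong Φ (ℕ.+-suc d i))) asc′
        (λ {e} e∈ → let _ , e< , e∣n = sound (there e∈) in
           All.lookup d<ds′ e∈ , subst (e <_) (ℕ.+-suc d m) e< , e∣n)
        (λ {e} d<e e< e∣n → tail d<e (complete (ℕ.<⇒≤ d<e) (subst (e <_) (sym (ℕ.+-suc d m)) e<) e∣n)))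
  where
  tail : ∀ {e d ds} → d < e → e ∈ d ∷ ds → e ∈ ds
  tail d<e (here refl) = contradiction d<e (ℕ.<-irrefl refl)
  tail d<e (there e∈)  = e∈

Psi-≡ : ∀ n → 0 < n → ∀ ds → AllPairs _<_ ds →
  (∀ {e} → e ∈ ds → 0 < e × e < n × e ∣ n) → (∀ {e} → e < n → e ∣ n → e ∈ ds) → Psi n ≡ ΠΦ ds
Psi-≡ (suc n) _ ds asc sound complete =
  trans (cong (prodDivisors (suc n) 1) (cyclotomicTable-≡ n))
    (prodDivisors-≡ (suc n) n 1 _ ds (λ _ → refl) asc sound (λ _ → complete))

Φ-exact : ∀ n → 0 < n → Monic (Psi n) → ∀ h N → (∀ k → N ≤ k → h k ≡ + 0) →
  act (Psi n) h ≗ coeff (xnMinus1 n) → Monic (Φ n) × coeff (Φ n) ≗ h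
Φ-exact (suc n) _ m h N h≗0 exact =
  Monic-divMonic n m h N h≗0 exact , divMonic-exact (xnMinus1 (suc n)) m h N h≗0 exact

prime∤⇒coprime : ∀ {p e} → Prime p → ¬ p ∣ e → Coprime e p
prime∤⇒coprime pr p∤e (d∣e , d∣p) with prime⇒irreducible pr d∣p
... | inj₁ d≡1  = d≡1
... | inj₂ refl = contradiction d∣e p∤e

-- If p divides e it cancels; otherwise e is coprime to p and divides n. Repeated use enumerates the
-- divisors of a product of primes.
∣prime*⇒ : ∀ {p e} n → Prime p → e ∣ p * n → e ∣ n ⊎ (∃[ e′ ] e ≡ p * e′ × e′ ∣ n)
∣prime*⇒ {p} {e} n pr e∣pn with p ∣? e
... | no  p∤e              = inj₁ (coprime-divisor (prime∤⇒coprime pr p∤e) e∣pn)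
... | yes (divides e′ e≡) = inj₂ (e′ , e≡′ , *-cancelˡ-∣ p (subst (_∣ p * n) e≡′ e∣pn))
  where
  e≡′ = trans e≡ (ℕ.*-comm e′ p)
  instance _ = prime⇒nonZero pr

-- The coefficients of Φ_pq

-- The power series 1/(x^p - 1).
inv : ℕ → Seq
inv p k = if does (p ∣? k) then ℤ.-1ℤ else + 0

inv-∣ : ∀ {p k} → p ∣ k → inv p k ≡ ℤ.-1ℤ
inv-∣ {p} {k} p∣k with p ∣? k
... | yes _  = refl
... | no p∤k = contradiction p∣k p∤k

inv-∤ : ∀ {p k} → ¬ p ∣ k → inv p k ≡ + 0
inv-∤ {p} {k} p∤k with p ∣? k
... | yes p∣k = contradiction p∣k p∤k
... | no _    = refl

inv-periodic : ∀ p k → inv p (p + k) ≡ inv p k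
inv-periodic p k with p ∣? k
... | yes p∣k = inv-∣ (∣m∣n⇒∣m+n ∣-refl p∣k)
... | no p∤k  = inv-∤ (λ p∣p+k → p∤k (∣m+n∣m⇒∣n p∣p+k ∣-refl))

act-inv : ∀ p → 0 < p → act (xnMinus1 p) (inv p) ≗ coeff oneP
act-inv p 0<p k = trans (act-xnMinus1 p (inv p) k) (difference k)
  where
  low : ∀ k → k < p → ℤ.- inv p k ≡ coeff oneP k
  low zero    _   = cong ℤ.-_ (inv-∣ (p ∣0))
  low (suc k) k<p = cong ℤ.-_ (inv-∤ (λ p∣k → ℕ.<⇒≱ k<p (∣⇒≤ p∣k)))
  high : ∀ p j → 0 < p → coeff oneP (p + j) ≡ + 0
  high (suc p) j _ = refl
  difference : ∀ k → S p (inv p) k ℤ.- inv p k ≡ coeff oneP k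
  difference k with ℕ.<-≤-connex k p
  ... | inj₁ k<p = trans (cong (ℤ._- inv p k) (S-below p (inv p) k<p)) (trans (ℤ.+-identityˡ _) (low k k<p))
  ... | inj₂ p≤k with ℕ.m≤n⇒∃[o]m+o≡n p≤k
  ...   | j , refl = trans (cong₂ ℤ._-_ (S-above p (inv p) j) (inv-periodic p j))
            (trans (ℤ.+-inverseʳ (inv p j)) (sym (high p j 0<p)))

S-vanish : ∀ n f {N} → (∀ k → N ≤ k → f k ≡ + 0) → ∀ k → n + N ≤ k → S n f k ≡ + 0
S-vanish n f f≗0 k l with ℕ.m≤n⇒∃[o]m+o≡n (ℕ.m+n≤o⇒m≤o n l)
... | j , refl = trans (S-above n f j) (f≗0 j (ℕ.+-cancelˡ-≤ n _ _ l))

U-vanish : ∀ n s f {N} → (∀ k → N ≤ k → f k ≡ + 0) → ∀ k → n * s + N ≤ k → U n s f k ≡ + 0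
U-vanish zero    s f f≗0 k l = refl
U-vanish (suc n) s f {N} f≗0 k l = cong₂ ℤ._+_ (f≗0 k (ℕ.m+n≤o⇒n≤o (suc n * s) l))
  (S-vanish s (U n s f) (U-vanish n s f f≗0) k (subst (_≤ k) (ℕ.+-assoc s (n * s) N) l))

-- The coefficient of `U n s f` at k is the sum of f i over all decompositions k = i + j s with j <
-- n; this form avoids subtraction. In `U-one` a single decomposition survives.
U-none : ∀ n s f k → (∀ {j} i → j < n → k ≡ i + j * s → f i ≡ + 0) → U n s f k ≡ + 0
U-none zero    s f k none = refl
U-none (suc n) s f k none = cong₂ ℤ._+_ (none k (s≤s z≤n) (sym (ℕ.+-identityʳ k))) tail
  where
  tail : S s (U n s f) k ≡ + 0
  tail with ℕ.<-≤-connex k s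
  ... | inj₁ k<s = S-below s (U n s f) k<s
  ... | inj₂ s≤k with ℕ.m≤n⇒∃[o]m+o≡n s≤k
  ...   | k′ , refl = trans (S-above s (U n s f) k′) (U-none n s f k′ λ {j} i j<n k′≡ →
            none i (s≤s j<n) (trans (cong (_+_ s) k′≡) (x∙yz≈y∙xz s i (j * s))))

U-one : ∀ n s f {j} i → j < n → (∀ {j′} i′ → j′ < n → i′ + j′ * s ≡ i + j * s → j′ ≢ j → f i′ ≡ + 0) →
  U n s f (i + j * s) ≡ f i
U-one (suc n) s f {zero} i _ others = begin
  f k ℤ.+ S s (U n s f) k
    ≡⟨ cong₂ ℤ._+_ (cong f (ℕ.+-identityʳ i)) tail ⟩
  f i ℤ.+ + 0
    ≡⟨ ℤ.+-identityʳ _ ⟩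
  f i ∎
  where
  open ≡-Reasoning
  k = i + 0
  tail : S s (U n s f) k ≡ + 0
  tail with ℕ.<-≤-connex k s
  ... | inj₁ k<s = S-below s (U n s f) k<s
  ... | inj₂ s≤k with ℕ.m≤n⇒∃[o]m+o≡n s≤k
  ...   | k′ , k≡ = trans (cong (S s (U n s f)) (sym k≡)) (trans (S-above s (U n s f) k′)
            (U-none n s f k′ λ {j} i′ j<n k′≡ → others i′ (s≤s j<n)
              (trans (x∙yz≈y∙xz i′ s (j * s)) (trans (cong (_+_ s) (sym k′≡)) k≡)) λ ()))
U-one (suc n) s f {suc j} i (s≤s j<n) others = begin
  f k ℤ.+ S s (U n s f) k
    ≡⟨ cong₂ ℤ._+_ (others k (s≤s z≤n) (ℕ.+-identityʳ k) λ ())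
         (trans (cong (S s (U n s f)) (x∙yz≈y∙xz i s (j * s))) (S-above s (U n s f) (i + j * s))) ⟩
  + 0 ℤ.+ U n s f (i + j * s)
    ≡⟨ ℤ.+-identityˡ _ ⟩
  U n s f (i + j * s)
    ≡⟨ U-one n s f i j<n (λ {j′} i′ j′<n eq j′≢j → others i′ (s≤s j′<n)
         (trans (x∙yz≈y∙xz i′ s (j′ * s)) (trans (cong (_+_ s) eq) (sym (x∙yz≈y∙xz i s (j * s)))))
         (λ eq′ → j′≢j (ℕ.suc-injective eq′))) ⟩
  f i ∎
  where
  open ≡-Reasoning
  k = i + suc j * s

-- The negative of the indicator of the numerical semigroup generated by p and q (coprime).
χ : ℕ → ℕ → Seq
χ p q = U p q (inv p)

-- Φ_pq as a power series: (x - 1) (x^pq - 1) / ((x^p - 1) (x^q - 1)).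
A : ℕ → ℕ → Seq
A p q = act (xnMinus1 1) (χ p q)

A-≡ : ∀ p q k → A p q k ≡ shift (χ p q) k ℤ.- χ p q k
A-≡ p q = act-xnMinus1 1 (χ p q)

module _ {p q : ℕ} (cop : Coprime p q) where

  private
    -- An equation a + αp = b + βp in naturals encodes a ≡ b (mod p), here and below. From jq ≡ j′q
    -- and coprimality, p divides j′ - j, which is less than p.
    residue-≤ : ∀ {j j′ α β} → j′ < p → j * q + α * p ≡ j′ * q + β * p → j ≤ j′ → j ≡ j′
    residue-≤ {j} {j′} {α} {β} j′<p eq j≤j′ with ℕ.m≤n⇒∃[o]m+o≡n j≤j′
    ... | d , refl with d
    ...   | zero   = sym (ℕ.+-identityʳ j)
    ...   | suc d′ = contradiction (∣⇒≤ p∣d) (ℕ.<⇒≱ (ℕ.≤-<-trans (ℕ.m≤n+m (suc d′) j) j′<p))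
      where
      αp≡ : α * p ≡ β * p + q * suc d′
      αp≡ = ℕ.+-cancelˡ-≡ (j * q) _ _ (trans eq (rearrange j (suc d′) q (β * p)))
        where
        rearrange : ∀ j d q b → (j + d) * q + b ≡ j * q + (b + q * d)
        rearrange = solveℕ-∀
      p∣d : p ∣ suc d′
      p∣d = coprime-divisor cop (∣m+n∣m⇒∣n (subst (p ∣_) αp≡ (n∣m*n α)) (n∣m*n β))

  residue-injective : ∀ {j j′ α β} → j < p → j′ < p → j * q + α * p ≡ j′ * q + β * p → j ≡ j′
  residue-injective {j} {j′} {α} {β} j<p j′<p eq with ℕ.≤-total j j′
  ... | inj₁ j≤j′ = residue-≤ {j} {j′} {α} {β} j′<p eq j≤j′
  ... | inj₂ j′≤j = sym (residue-≤ {j′} {j} {β} {α} j<p (sym eq) j′≤j)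

  -- The numbers jq with j < p represent every residue class modulo p once, and jq is the least
  -- semigroup element of its class (the Apéry set). Only the summand with jq ≡ n can contribute, so
  -- membership of n is decided by comparing n with jq, here and in `χ-gap`.
  χ-member : ∀ {j α β n} → j < p → j * q + α * p ≡ n + β * p → j * q ≤ n → χ p q n ≡ ℤ.-1ℤ
  χ-member {j} {α} {β} j<p eq jq≤n with ℕ.m≤n⇒∃[o]m+o≡n jq≤n
  ... | i , refl = trans (cong (χ p q) (ℕ.+-comm (j * q) i)) (trans
          (U-one p q (inv p) i j<p λ {j′} i′ j′<p eq′ j′≢j → inv-∤ {p} {i′} λ { (divides γ refl) →
            j′≢j (residue-injective {α = γ} {β = m} j′<p j<p
              (trans (ℕ.+-comm (j′ * q) (γ * p)) (trans eq′ (trans (ℕ.+-comm i (j * q)) (cong (_+_ (j * q)) i≡))))) })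
          (inv-∣ p∣i))
    where
    αp≡ : α * p ≡ β * p + i
    αp≡ = ℕ.+-cancelˡ-≡ (j * q) _ _ (trans eq (trans (ℕ.+-assoc (j * q) i (β * p)) (cong (_+_ (j * q)) (ℕ.+-comm i (β * p)))))
    p∣i : p ∣ i
    p∣i = ∣m+n∣m⇒∣n (subst (p ∣_) αp≡ (n∣m*n α)) (n∣m*n β)
    m = quotient p∣i
    i≡ : i ≡ m * p
    i≡ = _∣_.equality p∣i

  χ-gap : ∀ {j α β n} → j < p → j * q + α * p ≡ n + β * p → n < j * q → χ p q n ≡ + 0
  χ-gap {j} {α} {β} {n} j<p eq n<jq = U-none p q (inv p) n λ {j′} i j′<p n≡ → inv-∤ {p} {i} λ { (divides γ refl) →
    contradiction (subst (λ j → j * q ≤ n) (j′≡j γ j′ j′<p n≡) (subst (j′ * q ≤_) (sym n≡) (ℕ.m≤n+m (j′ * q) (γ * p))))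
                  (ℕ.<⇒≱ n<jq) }
    where
    j′≡j : ∀ γ j′ → j′ < p → n ≡ γ * p + j′ * q → j′ ≡ j
    j′≡j γ j′ j′<p n≡ = residue-injective {α = γ + β} {β = α} j′<p j<p
      (trans (rearrange (j′ * q) γ β p) (trans (cong (_+ β * p) (sym n≡)) (sym eq)))
      where
      rearrange : ∀ a γ β p → a + (γ + β) * p ≡ γ * p + a + β * p
      rearrange = solveℕ-∀

  inverse : 1 < p → ∃[ y ] ∃[ x ] y * q ≡ 1 + x * p
  inverse 1<p with coprime-Bézout cop
  ... | Bézout.-+ x y eq = y , x , sym eq
  ... | Bézout.+- x y eq = negate p 1<p x eq
    where
    -- In this case yq ≡ -1 (mod p), so (p - 1)y is an inverse of q.
    negate : ∀ p → 1 < p → ∀ x → 1 + y * q ≡ x * p → ∃[ y ] ∃[ x ] y * q ≡ 1 + x * p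
    negate (suc (suc p)) (s≤s _) (suc x) eq = suc p * y , p + suc p * x , (begin
      suc p * y * q                     ≡⟨ ℕ.*-assoc (suc p) y q ⟩
      suc p * (y * q)                   ≡⟨ cong (suc p *_) (ℕ.suc-injective eq) ⟩
      suc p * (suc p + x * suc (suc p)) ≡⟨ expand p x ⟩
      1 + (p + suc p * x) * suc (suc p) ∎)
      where
      open ≡-Reasoning
      expand : ∀ p x → (1 + p) * ((1 + p) + x * (2 + p)) ≡ 1 + (p + (1 + p) * x) * (2 + p)
      expand = solveℕ-∀

  residue-surjective : 1 < p → ∀ n → ∃[ j ] ∃[ α ] ∃[ β ] (j < p × j * q + α * p ≡ n + β * p)
  residue-surjective 1<p n with inverse 1<p
  -- As y inverts q modulo p, the class of n is that of jq for j = ny mod p.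
  ... | y , x , yq≡ = (n * y) % p , (n * y) / p * q , n * x , m%n<n (n * y) p , (begin
    (n * y) % p * q + (n * y) / p * q * p   ≡⟨ factor ((n * y) % p) ((n * y) / p) q p ⟩
    ((n * y) % p + (n * y) / p * p) * q     ≡⟨ cong (_* q) (m≡m%n+[m/n]*n (n * y) p) ⟨
    n * y * q                               ≡⟨ ℕ.*-assoc n y q ⟩
    n * (y * q)                             ≡⟨ cong (n *_) yq≡ ⟩
    n * (1 + x * p)                         ≡⟨ expand n x p ⟩
    n + n * x * p                           ∎)
    where
    open ≡-Reasoning
    instance _ = >-nonZero (ℕ.<-trans (s≤s z≤n) 1<p)
    factor : ∀ a b q p → a * q + b * q * p ≡ (a + b * p) * q
    factor = solveℕ-∀
    expand : ∀ n x p → n * (1 + x * p) ≡ n + n * x * p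
    expand = solveℕ-∀

  -- A gap lies below the Apéry element jq of its class, and j ≤ p - 1.
  χ-dichotomy : 1 < p → ∀ n → χ p q n ≡ ℤ.-1ℤ ⊎ (χ p q n ≡ + 0 × n < (p ∸ 1) * q)
  χ-dichotomy 1<p n = decide (residue-surjective 1<p n)
    where
    decide : ∃[ j ] ∃[ α ] ∃[ β ] (j < p × j * q + α * p ≡ n + β * p) → χ p q n ≡ ℤ.-1ℤ ⊎ (χ p q n ≡ + 0 × n < (p ∸ 1) * q)
    decide (j , α , β , j<p , eq) with ℕ.<-≤-connex n (j * q)
    ... | inj₂ jq≤n = inj₁ (χ-member {α = α} {β} j<p eq jq≤n)
    ... | inj₁ n<jq = inj₂ (χ-gap {α = α} {β} j<p eq n<jq
                           , ℕ.<-≤-trans n<jq (ℕ.*-monoˡ-≤ q (ℕ.m+n≤o⇒m≤o∸n j (subst (_≤ p) (ℕ.+-comm 1 j) j<p))))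

  A-bounded : 1 < p → ∀ k → ℤ.∣ A p q k ∣ ≤ 1
  A-bounded 1<p k = subst (λ z → ℤ.∣ z ∣ ≤ 1) (sym (A-≡ p q k)) (difference (shift-value k) (value k))
    where
    value : ∀ k → χ p q k ≡ ℤ.-1ℤ ⊎ χ p q k ≡ + 0
    value k = map₂ proj₁ (χ-dichotomy 1<p k)
    shift-value : ∀ k → shift (χ p q) k ≡ ℤ.-1ℤ ⊎ shift (χ p q) k ≡ + 0
    shift-value zero    = inj₂ refl
    shift-value (suc k) = value k
    difference : ∀ {x y} → x ≡ ℤ.-1ℤ ⊎ x ≡ + 0 → y ≡ ℤ.-1ℤ ⊎ y ≡ + 0 → ℤ.∣ x ℤ.- y ∣ ≤ 1
    difference (inj₁ refl) (inj₁ refl) = z≤n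
    difference (inj₁ refl) (inj₂ refl) = s≤s z≤n
    difference (inj₂ refl) (inj₁ refl) = s≤s z≤n
    difference (inj₂ refl) (inj₂ refl) = z≤n

  -- From (p-1)q on there are no gaps, so consecutive values agree. The bound exceeds the degree
  -- (p-1)(q-1) but does not exceed (p-1)r when q < r, as used later.
  A-vanish : 1 < p → ∀ k → suc ((p ∸ 1) * q) ≤ k → A p q k ≡ + 0
  A-vanish 1<p (suc k) (s≤s l) = trans (A-≡ p q (suc k)) (cong₂ ℤ._-_ (above k l) (above (suc k) (ℕ.m≤n⇒m≤1+n l)))
    where
    above : ∀ k → (p ∸ 1) * q ≤ k → χ p q k ≡ ℤ.-1ℤ
    above k l = fromInj₁ (λ (_ , l′) → contradiction l (ℕ.<⇒≱ l′)) (χ-dichotomy 1<p k)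

-- The polynomial Ψ_pqr

open CommutativeMonoid polyMonoid using () renaming
  (refl to ≈-refl; sym to ≈-sym; trans to ≈-trans; ∙-cong to mulP-cong)
open MonoidSolver polyMonoid using (solve; _⊜_; _⊕_; id)

1<prime : ∀ {p} → Prime p → 1 < p
1<prime {p} pr = nonTrivial⇒n>1 p where instance _ = prime⇒nonTrivial pr

primes-coprime : ∀ {p q} → Prime p → Prime q → p < q → Coprime p q
primes-coprime {p} {q} pp pq p<q = Coprime.sym (Coprime.prime⇒coprime pq p<q)
  where instance _ = prime⇒nonZero pp

∣pq⇒ : ∀ {p q e} → Prime p → Prime q → e ∣ p * q → e ∈ 1 ∷ p ∷ q ∷ p * q ∷ []
∣pq⇒ {p} {q} pp pq e∣ with ∣prime*⇒ q pp e∣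
... | inj₁ e∣q with prime⇒irreducible pq e∣q
...   | inj₁ refl = here refl
...   | inj₂ refl = there (there (here refl))
∣pq⇒ {p} {q} pp pq e∣ | inj₂ (e′ , refl , e′∣q) with prime⇒irreducible pq e′∣q
...   | inj₁ refl = there (here (ℕ.*-identityʳ p))
...   | inj₂ refl = there (there (there (here refl)))

Psi-prime : ∀ {p} → Prime p → Psi p ≡ ΠΦ (1 ∷ [])
Psi-prime {p} pp = Psi-≡ p (ℕ.<⇒≤ (1<prime pp)) _ (Linked⇒AllPairs ℕ.<-trans [-])
  (λ { (here refl) → s≤s z≤n , 1<prime pp , 1∣ p })
  (λ {e} e<p e∣p → complete e<p (prime⇒irreducible pp e∣p))
  where
  complete : ∀ {e} → e < p → e ≡ 1 ⊎ e ≡ p → e ∈ 1 ∷ []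
  complete e<p (inj₁ refl) = here refl
  complete e<p (inj₂ refl) = contradiction e<p (ℕ.<-irrefl refl)

module _ {p q} (pp : Prime p) (pq : Prime q) (p<q : p < q) where

  private
    0<p = ℕ.<⇒≤ (1<prime pp)
    0<q = ℕ.<-trans 0<p p<q
    instance
      _ = prime⇒nonZero pp
      _ = prime⇒nonZero pq

  q<pq : q < p * q
  q<pq = subst (q <_) (ℕ.*-comm q p) (ℕ.m<m*n q p (1<prime pp))

  Psi-pq : Psi (p * q) ≡ ΠΦ (1 ∷ p ∷ q ∷ [])
  Psi-pq = Psi-≡ (p * q) (ℕ.<-trans 0<q q<pq) _ (Linked⇒AllPairs ℕ.<-trans (1<prime pp ∷ p<q ∷ [-])) sound
    (λ e<pq e∣pq → complete e<pq (∣pq⇒ pp pq e∣pq))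
    where
    sound : ∀ {e} → e ∈ 1 ∷ p ∷ q ∷ [] → 0 < e × e < p * q × e ∣ p * q
    sound (here refl)                 = s≤s z≤n , ℕ.<-trans (1<prime pq) q<pq , 1∣ _
    sound (there (here refl))         = 0<p , ℕ.<-trans p<q q<pq , m∣m*n q
    sound (there (there (here refl))) = 0<q , q<pq , n∣m*n p
    complete : ∀ {e} → e < p * q → e ∈ 1 ∷ p ∷ q ∷ p * q ∷ [] → e ∈ 1 ∷ p ∷ q ∷ []
    complete e<pq (here refl)                         = here refl
    complete e<pq (there (here refl))                 = there (here refl)
    complete e<pq (there (there (here refl)))         = there (there (here refl))
    complete e<pq (there (there (there (here refl)))) = contradiction e<pq (ℕ.<-irrefl refl)

  module _ {r} (pr : Prime r) (q<r : q < r) (r<pq : r < p * q) where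

    private
      0<r = ℕ.<-trans 0<q q<r
      instance
        _ = prime⇒nonZero pr
      pq<pr = ℕ.*-monoʳ-< p q<r
      pr<qr = ℕ.*-monoˡ-< r p<q
      qr<pqr : q * r < p * q * r
      qr<pqr = ℕ.*-monoˡ-< r q<pq
      ds : List ℕ
      ds = 1 ∷ p ∷ q ∷ r ∷ p * q ∷ p * r ∷ q * r ∷ []

    -- The assumption r < pq fixes the order of the divisors, making the list ascending. Each
    -- divisor of pqr divides pq or is r times a divisor of pq.
    Psi-pqr : Psi (p * q * r) ≡ ΠΦ (1 ∷ p ∷ q ∷ r ∷ p * q ∷ p * r ∷ q * r ∷ [])
    Psi-pqr = Psi-≡ (p * q * r) (ℕ.≤-<-trans z≤n qr<pqr) ds
      (Linked⇒AllPairs ℕ.<-trans (1<prime pp ∷ p<q ∷ q<r ∷ r<pq ∷ pq<pr ∷ pr<qr ∷ [-])) sound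
      (λ {e} e<pqr e∣pqr → complete e<pqr (∣prime*⇒ (p * q) pr (subst (e ∣_) (ℕ.*-comm (p * q) r) e∣pqr)))
      where
      pq<qr = ℕ.<-trans pq<pr pr<qr
      r<qr = ℕ.<-trans r<pq pq<qr
      q<qr = ℕ.<-trans q<r r<qr
      below : ∀ {e} → e ≤ q * r → e < p * q * r
      below e≤qr = ℕ.≤-<-trans e≤qr qr<pqr
      sound : ∀ {e} → e ∈ ds → 0 < e × e < p * q * r × e ∣ p * q * r
      sound (here refl)                                 = s≤s z≤n , below (ℕ.<⇒≤ (ℕ.<-trans (1<prime pq) q<qr)) , 1∣ _
      sound (there (here refl))                         = 0<p , below (ℕ.<⇒≤ (ℕ.<-trans p<q q<qr)) , ∣-trans (m∣m*n {p} q) (m∣m*n r)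
      sound (there (there (here refl)))                 = 0<q , below (ℕ.<⇒≤ q<qr) , n∣m*n*o p r
      sound (there (there (there (here refl))))         = 0<r , below (ℕ.<⇒≤ r<qr) , n∣m*n (p * q)
      sound (there (there (there (there (here refl))))) = ℕ.<-trans 0<r r<pq , below (ℕ.<⇒≤ pq<qr) , m∣m*n r
      sound (there (there (there (there (there (here refl)))))) =
        ℕ.≤-<-trans z≤n pq<pr , below (ℕ.<⇒≤ pr<qr) , *-monoˡ-∣ r (m∣m*n {p} q)
      sound (there (there (there (there (there (there (here refl))))))) =
        ℕ.≤-<-trans z≤n pr<qr , qr<pqr , *-monoˡ-∣ r (n∣m*n p)
      pq-divisor : ∀ {e} → e ∈ 1 ∷ p ∷ q ∷ p * q ∷ [] → e ∈ ds
      pq-divisor (here refl)                         = here refl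
      pq-divisor (there (here refl))                 = there (here refl)
      pq-divisor (there (there (here refl)))         = there (there (here refl))
      pq-divisor (there (there (there (here refl)))) = there (there (there (there (here refl))))
      r-multiple : ∀ {e} → r * e < p * q * r → e ∈ 1 ∷ p ∷ q ∷ p * q ∷ [] → r * e ∈ ds
      r-multiple _ (here refl)                           = there (there (there (here (ℕ.*-identityʳ r))))
      r-multiple _ (there (here refl))                   = there (there (there (there (there (here (ℕ.*-comm r p))))))
      r-multiple _ (there (there (here refl)))           = there (there (there (there (there (there (here (ℕ.*-comm r q)))))))
      r-multiple re<pqr (there (there (there (here refl)))) = contradiction re<pqr (ℕ.<-irrefl (ℕ.*-comm r (p * q)))
      complete : ∀ {e} → e < p * q * r → e ∣ p * q ⊎ (∃[ e′ ] e ≡ r * e′ × e′ ∣ p * q) → e ∈ ds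
      complete e<pqr (inj₁ e∣pq)               = pq-divisor (∣pq⇒ pp pq e∣pq)
      complete e<pqr (inj₂ (e′ , refl , e′∣pq)) = r-multiple e<pqr (∣pq⇒ pp pq e′∣pq)

-- The quotient exhibited is 1 + x + ⋯ + x^(p-1), and `Φ 1` computes to x - 1.
Φ-prime : ∀ {p} → Prime p → Monic (Φ p) × mulP (Φ 1) (Φ p) ≈ xnMinus1 p
Φ-prime {p} pp = proj₁ exact , ≈-intro λ k → begin
  coeff (mulP (Φ 1) (Φ p)) k   ≡⟨ coeff-mulP (Φ 1) (Φ p) k ⟩
  act (Φ 1) (coeff (Φ p)) k    ≡⟨ act-cong (Φ 1) (proj₂ exact) k ⟩
  act (xnMinus1 1) (U p 1 δ) k ≡⟨ geometric k ⟩
  coeff (xnMinus1 p) k         ∎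
  where
  open ≡-Reasoning
  δ = coeff oneP
  geometric : act (xnMinus1 1) (U p 1 δ) ≗ coeff (xnMinus1 p)
  geometric k = begin
    act (xnMinus1 1) (U p 1 δ) k ≡⟨ act-xnMinus1-U p 1 δ k ⟩
    act (xnMinus1 (p * 1)) δ k   ≡⟨ cong (λ n → act (xnMinus1 n) δ k) (ℕ.*-identityʳ p) ⟩
    act (xnMinus1 p) δ k         ≡⟨ act-oneP (xnMinus1 p) k ⟩
    coeff (xnMinus1 p) k         ∎
  exact : Monic (Φ p) × coeff (Φ p) ≗ U p 1 δ
  exact = Φ-exact p (ℕ.<⇒≤ (1<prime pp)) (subst Monic (sym (Psi-prime pp)) (ℤ.-1ℤ ∷ one)) (U p 1 δ) (p * 1 + 1)
    (U-vanish p 1 δ (λ _ → coeff-beyond oneP))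
    λ k → trans (cong (λ P → act P (U p 1 δ) k) (Psi-prime pp)) (geometric k)

module _ {p q} (pp : Prime p) (pq : Prime q) (p<q : p < q) where

  private
    cop = primes-coprime pp pq p<q
    X = xnMinus1
    f = A p q
    Ψ = ΠΦ (1 ∷ p ∷ q ∷ [])

  Φ1*Psi-pq : mulP (Φ 1) Ψ ≈ mulP (X p) (X q)
  Φ1*Psi-pq = ≈-trans
    (solve 3 (λ a b c → a ⊕ (a ⊕ (b ⊕ (c ⊕ id))) ⊜ (a ⊕ b) ⊕ (a ⊕ c)) ≈-refl (Φ 1) (Φ p) (Φ q))
    (mulP-cong (proj₂ (Φ-prime pp)) (proj₂ (Φ-prime pq)))

  private
    -- Multiplying by x - 1 turns Ψ_pq into (x^p - 1)(x^q - 1), whose factors undo the denominators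
    -- of the series `A p q`; then x - 1 is cancelled.
    exact : act Ψ f ≗ coeff (X (p * q))
    exact = act-xnMinus1-injective 1 (s≤s z≤n) _ _ λ k → begin
      act (X 1) (act Ψ f) k                               ≡⟨ act-mulP (X 1) Ψ f k ⟨
      act (mulP (X 1) Ψ) f k                              ≡⟨ act-coeff (mulP (X 1) Ψ) (mulP (X p) (X q)) (coeffs Φ1*Psi-pq) f k ⟩
      act (mulP (X p) (X q)) f k                          ≡⟨ act-mulP (X p) (X q) f k ⟩
      act (X p) (act (X q) (act (X 1) (U p q (inv p)))) k ≡⟨ act-cong (X p) (act-comm (X q) (X 1) _) k ⟩
      act (X p) (act (X 1) (act (X q) (U p q (inv p)))) k ≡⟨ act-comm (X p) (X 1) _ k ⟩
      act (X 1) (act (X p) (act (X q) (U p q (inv p)))) k ≡⟨ act-cong (X 1) reduce k ⟩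
      act (X 1) (coeff (X (p * q))) k                     ∎
      where
      open ≡-Reasoning
      reduce : act (X p) (act (X q) (U p q (inv p))) ≗ coeff (X (p * q))
      reduce k = begin
        act (X p) (act (X q) (U p q (inv p))) k  ≡⟨ act-cong (X p) (act-xnMinus1-U p q (inv p)) k ⟩
        act (X p) (act (X (p * q)) (inv p)) k    ≡⟨ act-comm (X p) (X (p * q)) (inv p) k ⟩
        act (X (p * q)) (act (X p) (inv p)) k    ≡⟨ act-cong (X (p * q)) (act-inv p (ℕ.<⇒≤ (1<prime pp))) k ⟩
        act (X (p * q)) (coeff oneP) k           ≡⟨ act-oneP (X (p * q)) k ⟩
        coeff (X (p * q)) k                      ∎

  coeff-Φpq : coeff (Φ (p * q)) ≗ A p q
  coeff-Φpq = proj₂ (Φ-exact (p * q) (ℕ.≤-<-trans z≤n (q<pq pp pq p<q))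
    (subst Monic (sym (Psi-pq pp pq p<q))
      (Monic-mulP (ℤ.-1ℤ ∷ one) (Monic-mulP (proj₁ (Φ-prime pp)) (Monic-mulP (proj₁ (Φ-prime pq)) one))))
    f _ (A-vanish cop (1<prime pp))
    λ k → trans (cong (λ P → act P f k) (Psi-pq pp pq p<q)) (exact k))

  Φpq-exact : mulP Ψ (Φ (p * q)) ≈ X (p * q)
  Φpq-exact = ≈-intro λ k → trans (coeff-mulP Ψ (Φ (p * q)) k)
    (trans (act-cong Ψ coeff-Φpq k) (exact k))

-- Multiply by x^r - 1 = Φ_1 Φ_r. The factors regroup as Φ_1 Φ_p Φ_r Φ_pr = x^(pr) - 1, Φ_1 Φ_q Φ_r
-- Φ_qr = x^(qr) - 1 and Φ_pq; dividing x^(pr) - 1 by x^r - 1 leaves the geometric sum.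
Psi-pqr-coeff : ∀ {p q r} → Prime p → Prime q → Prime r → p < q → q < r → r < p * q →
  coeff (Psi (p * q * r)) ≗ act (xnMinus1 (q * r)) (U p r (A p q))
Psi-pqr-coeff {p} {q} {r} pp pq pr p<q q<r r<pq =
  act-xnMinus1-injective r (ℕ.<⇒≤ (1<prime pr)) _ _ λ k → begin
  act (X r) (coeff (Psi (p * q * r))) k             ≡⟨ cong (λ P → act (X r) (coeff P) k) (Psi-pqr pp pq p<q pr q<r r<pq) ⟩
  act (X r) (coeff Ψ) k                             ≡⟨ coeff-mulP (X r) Ψ k ⟨
  coeff (mulP (X r) Ψ) k                            ≡⟨ coeffs regroup k ⟩
  coeff (mulP (X (p * r)) (mulP (X (q * r)) (Φ (p * q)))) k ≡⟨ coeff-mulP (X (p * r)) _ k ⟩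
  act (X (p * r)) (coeff (mulP (X (q * r)) (Φ (p * q)))) k
    ≡⟨ act-cong (X (p * r)) (λ j → trans (coeff-mulP (X (q * r)) (Φ (p * q)) j)
         (act-cong (X (q * r)) (coeff-Φpq pp pq p<q) j)) k ⟩
  act (X (p * r)) (act (X (q * r)) f) k             ≡⟨ act-comm (X (p * r)) (X (q * r)) f k ⟩
  act (X (q * r)) (act (X (p * r)) f) k             ≡⟨ act-cong (X (q * r)) (act-xnMinus1-U p r f) k ⟨
  act (X (q * r)) (act (X r) (U p r f)) k           ≡⟨ act-comm (X (q * r)) (X r) (U p r f) k ⟩
  act (X r) (act (X (q * r)) (U p r f)) k           ∎
  where
  open ≡-Reasoning
  X = xnMinus1
  f = A p q
  Ψ = ΠΦ (1 ∷ p ∷ q ∷ r ∷ p * q ∷ p * r ∷ q * r ∷ [])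
  p<r = ℕ.<-trans p<q q<r
  regroup : mulP (X r) Ψ ≈ mulP (X (p * r)) (mulP (X (q * r)) (Φ (p * q)))
  regroup = ≈-trans (mulP-cong (≈-sym (proj₂ (Φ-prime pr))) (≈-refl {Ψ}))
    (≈-trans
      (solve 7 (λ a b c d e f g → (a ⊕ d) ⊕ (a ⊕ (b ⊕ (c ⊕ (d ⊕ (e ⊕ (f ⊕ (g ⊕ id)))))))
          ⊜ ((a ⊕ (b ⊕ (d ⊕ id))) ⊕ f) ⊕ (((a ⊕ (c ⊕ (d ⊕ id))) ⊕ g) ⊕ e))
        ≈-refl (Φ 1) (Φ p) (Φ q) (Φ r) (Φ (p * q)) (Φ (p * r)) (Φ (q * r)))
      (mulP-cong (Φpq-exact pp pr p<r) (mulP-cong (Φpq-exact pq pr q<r) (≈-refl {Φ (p * q)}))))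

-- Coefficient bounds and the degree of Ψ_pqr

U-at : ∀ n s f k → U (suc n) s f (s + k) ≡ f (s + k) ℤ.+ U n s f k
U-at n s f k = cong (ℤ._+_ (f (s + k))) (S-above s (U n s f) k)

U-low : ∀ n s f {k} → k < s → U (suc n) s f k ≡ f k
U-low n s f {k} k<s = trans (cong (ℤ._+_ (f k)) (S-below s (U n s f) k<s)) (ℤ.+-identityʳ _)

U-bounded-below : ∀ n s f → (∀ k → ℤ.∣ f k ∣ ≤ 1) → ∀ M k → k < M * s → ℤ.∣ U n s f k ∣ ≤ M
U-bounded-below zero    s f bounded M       k k<Ms = z≤n
U-bounded-below (suc n) s f bounded (suc M) k k<Ms = [ low , high ]′ (ℕ.<-≤-connex k s)
  where
  open ℕ.≤-Reasoning
  low : k < s → ℤ.∣ U (suc n) s f k ∣ ≤ suc M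
  low k<s = begin
    ℤ.∣ U (suc n) s f k ∣  ≡⟨ cong ℤ.∣_∣ (U-low n s f k<s) ⟩
    ℤ.∣ f k ∣              ≤⟨ bounded k ⟩
    1                      ≤⟨ s≤s z≤n ⟩
    suc M                  ∎
  high : s ≤ k → ℤ.∣ U (suc n) s f k ∣ ≤ suc M
  high s≤k with ℕ.m≤n⇒∃[o]m+o≡n s≤k
  ... | j , refl = begin
    ℤ.∣ U (suc n) s f (s + j) ∣           ≡⟨ cong ℤ.∣_∣ (U-at n s f j) ⟩
    ℤ.∣ f (s + j) ℤ.+ U n s f j ∣         ≤⟨ ℤ.∣i+j∣≤∣i∣+∣j∣ (f (s + j)) (U n s f j) ⟩
    ℤ.∣ f (s + j) ∣ + ℤ.∣ U n s f j ∣     ≤⟨ ℕ.+-mono-≤ (bounded (s + j))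
                                              (U-bounded-below n s f bounded M j (ℕ.+-cancelˡ-< s _ _ k<Ms)) ⟩
    suc M                                 ∎

-- At most M of the arguments k, k - s, k - 2s, … lie in [0, M s), and f vanishes beyond.
U-bounded : ∀ n s f → (∀ k → ℤ.∣ f k ∣ ≤ 1) → ∀ M → (∀ k → M * s ≤ k → f k ≡ + 0) →
  ∀ k → ℤ.∣ U n s f k ∣ ≤ M
U-bounded zero    s f bounded M f≗0 k = z≤n
U-bounded (suc n) s f bounded M f≗0 k =
  [ U-bounded-below (suc n) s f bounded M k , (λ Ms≤k → [ low Ms≤k , high Ms≤k ]′ (ℕ.<-≤-connex k s)) ]′
  (ℕ.<-≤-connex k (M * s))
  where
  open ℕ.≤-Reasoning
  low : M * s ≤ k → k < s → ℤ.∣ U (suc n) s f k ∣ ≤ M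
  low Ms≤k k<s = begin
    ℤ.∣ U (suc n) s f k ∣  ≡⟨ cong ℤ.∣_∣ (trans (U-low n s f k<s) (f≗0 k Ms≤k)) ⟩
    0                      ≤⟨ z≤n ⟩
    M                      ∎
  high : M * s ≤ k → s ≤ k → ℤ.∣ U (suc n) s f k ∣ ≤ M
  high Ms≤k s≤k with ℕ.m≤n⇒∃[o]m+o≡n s≤k
  ... | j , refl = begin
    ℤ.∣ U (suc n) s f (s + j) ∣     ≡⟨ cong ℤ.∣_∣ (trans (U-at n s f j) (cong (ℤ._+ U n s f j) (f≗0 (s + j) Ms≤k))) ⟩
    ℤ.∣ + 0 ℤ.+ U n s f j ∣         ≡⟨ cong ℤ.∣_∣ (ℤ.+-identityˡ (U n s f j)) ⟩
    ℤ.∣ U n s f j ∣                 ≤⟨ U-bounded n s f bounded M f≗0 j ⟩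
    M                               ∎

-- Since o < s and m < n, the arguments that enter the sum are exactly o + is with i ≤ m.
U-constant : ∀ n s f o ε m → o < s → m < n → (∀ i → i ≤ m → f (o + i * s) ≡ ε) →
  U n s f (o + m * s) ≡ + suc m ℤ.* ε
U-constant (suc n) s f o ε zero    o<s _         const = begin
  U (suc n) s f (o + 0)   ≡⟨ U-low n s f (subst (_< s) (sym (ℕ.+-identityʳ o)) o<s) ⟩
  f (o + 0)               ≡⟨ const 0 z≤n ⟩
  ε                       ≡⟨ ℤ.*-identityˡ ε ⟨
  + 1 ℤ.* ε               ∎
  where open ≡-Reasoning
U-constant (suc n) s f o ε (suc m) o<s (s≤s m<n) const = begin
  U (suc n) s f (o + suc m * s)                     ≡⟨ cong (U (suc n) s f) next ⟩
  U (suc n) s f (s + (o + m * s))                   ≡⟨ U-at n s f (o + m * s) ⟩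
  f (s + (o + m * s)) ℤ.+ U n s f (o + m * s)
    ≡⟨ cong₂ ℤ._+_ (trans (cong f (sym next)) (const (suc m) ℕ.≤-refl))
         (U-constant n s f o ε m o<s m<n λ i i≤m → const i (ℕ.m≤n⇒m≤1+n i≤m)) ⟩
  ε ℤ.+ + suc m ℤ.* ε                               ≡⟨ ℤ.suc-* (+ suc m) ε ⟨
  + suc (suc m) ℤ.* ε                               ∎
  where
  open ≡-Reasoning
  next : o + suc m * s ≡ s + (o + m * s)
  next = x∙yz≈y∙xz o s (m * s)

-- Counting multiples and bounding the totient

∑ : (ℕ → ℕ) → ℕ → ℕ
∑ f zero    = 0
∑ f (suc n) = ∑ f n + f n

∑-mono : ∀ {f g} → (∀ k → f k ≤ g k) → ∀ n → ∑ f n ≤ ∑ g n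
∑-mono f≤g zero    = z≤n
∑-mono f≤g (suc n) = ℕ.+-mono-≤ (∑-mono f≤g n) (f≤g n)

∑-+ : ∀ f g n → ∑ (λ k → f k + g k) n ≡ ∑ f n + ∑ g n
∑-+ f g zero    = refl
∑-+ f g (suc n) = trans (cong (_+ (f n + g n)) (∑-+ f g n)) (interchange (∑ f n) (∑ g n) (f n) (g n))
  where
  interchange : ∀ a b c d → a + b + (c + d) ≡ a + c + (b + d)
  interchange = solveℕ-∀

∑-1 : ∀ n → ∑ (λ _ → 1) n ≡ n
∑-1 zero    = refl
∑-1 (suc n) = trans (cong (_+ 1) (∑-1 n)) (ℕ.+-comm n 1)

indicator : ∀ {a} {A : Set a} → Dec A → ℕ
indicator a? = if does a? then 1 else 0

indicator-yes : ∀ {a} {A : Set a} (a? : Dec A) → A → indicator a? ≡ 1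
indicator-yes (yes _) a = refl
indicator-yes (no ¬a) a = contradiction a ¬a

indicator-no : ∀ {a} {A : Set a} (a? : Dec A) → ¬ A → indicator a? ≡ 0
indicator-no (yes a) ¬a = contradiction a ¬a
indicator-no (no _)  ¬a = refl

length-filter-upTo : ∀ {ℓ} {P : Pred ℕ ℓ} (P? : Decidable P) n →
  length (filter P? (upTo n)) ≡ ∑ (λ k → indicator (P? k)) n
length-filter-upTo P? zero    = refl
length-filter-upTo P? (suc n) = begin
  length (filter P? (upTo (suc n)))                          ≡⟨ cong (λ l → length (filter P? l)) (upTo-∷ʳ n) ⟨
  length (filter P? (upTo n ++ (n ∷ [])))                    ≡⟨ cong length (filter-++ P? (upTo n) (n ∷ [])) ⟩
  length (filter P? (upTo n) ++ filter P? (n ∷ []))          ≡⟨ length-++ (filter P? (upTo n)) ⟩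
  length (filter P? (upTo n)) + length (filter P? (n ∷ []))  ≡⟨ cong₂ _+_ (length-filter-upTo P? n) last ⟩
  ∑ (λ k → indicator (P? k)) n + indicator (P? n)            ∎
  where
  open ≡-Reasoning
  last : length (filter P? (n ∷ [])) ≡ indicator (P? n)
  last with does (P? n)
  ... | true  = refl
  ... | false = refl

∑-multiples : ∀ d → 0 < d → ∀ m → ∑ (λ k → indicator (d ∣? suc k)) (m * d) ≡ m
∑-multiples (suc d) 0<d m = trans (cong (∑ f) (sym (ℕ.+-identityʳ (m * suc d)))) (count m 0 (s≤s z≤n))
  where
  f = λ k → indicator (suc d ∣? suc k)
  -- After m full blocks of length d, the next j < d entries add no multiple; the new one appears
  -- when a block is completed.
  count : ∀ m j → j < suc d → ∑ f (m * suc d + j) ≡ m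
  count m       (suc j) j<d rewrite ℕ.+-suc (m * suc d) j = trans
    (cong₂ _+_ (count m j (ℕ.<-trans ℕ.≤-refl j<d))
      (indicator-no (suc d ∣? suc (m * suc d + j)) λ d∣ →
        ℕ.<⇒≱ j<d (∣⇒≤ (∣m+n∣m⇒∣n (subst (suc d ∣_) (sym (ℕ.+-suc (m * suc d) j)) d∣) (n∣m*n m)))))
    (ℕ.+-identityʳ m)
  count zero    zero    _   = refl
  count (suc m) zero    _   rewrite ℕ.+-identityʳ (d + m * suc d) | ℕ.+-comm d (m * suc d) = trans
    (cong₂ _+_ (count m d ℕ.≤-refl)
      (indicator-yes (suc d ∣? suc (m * suc d + d)) (subst (suc d ∣_) (ℕ.+-suc (m * suc d) d) (∣m∣n⇒∣m+n (n∣m*n m) ∣-refl))))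
    (ℕ.+-comm m 1)

coprime-*-∣ : ∀ {p q e} → Coprime p q → p ∣ e → q ∣ e → p * q ∣ e
coprime-*-∣ {p} {q} cop (divides a refl) q∣ap =
  subst (p * q ∣_) (ℕ.*-comm p a) (*-monoʳ-∣ p (coprime-divisor (Coprime.sym cop) (subst (q ∣_) (ℕ.*-comm a p) q∣ap)))

-- Inclusion–exclusion over the multiples of p and of q only.
totient-pqr : ∀ {p q} r → Coprime p q → 1 < p → 1 < q →
  totient (p * q * r) + (q * r + p * r) ≤ p * q * r + r
totient-pqr {p} {q} r cop 1<p 1<q = begin
  totient n + (q * r + p * r)
    ≡⟨ cong₂ _+_ (length-filter-upTo (λ k → gcd (suc k) n ≟ 1) n) (cong₂ _+_
         (count p 0<p (q * r) (perm₁ q r p)) (count q 0<q (p * r) (perm₂ p r q))) ⟩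
  ∑ a n + (∑ (mult p) n + ∑ (mult q) n)       ≡⟨ cong (_+_ (∑ a n)) (∑-+ (mult p) (mult q) n) ⟨
  ∑ a n + ∑ (λ k → mult p k + mult q k) n     ≡⟨ ∑-+ a _ n ⟨
  ∑ (λ k → a k + (mult p k + mult q k)) n     ≤⟨ ∑-mono pointwise n ⟩
  ∑ (λ k → 1 + mult (p * q) k) n              ≡⟨ ∑-+ (λ _ → 1) (mult (p * q)) n ⟩
  ∑ (λ _ → 1) n + ∑ (mult (p * q)) n
    ≡⟨ cong₂ _+_ (∑-1 n) (sym (count (p * q) (ℕ.*-mono-≤ 0<p 0<q) r (ℕ.*-comm r (p * q)))) ⟩
  n + r                                       ∎
  where
  open ℕ.≤-Reasoning
  n = p * q * r
  0<p = ℕ.<⇒≤ 1<p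
  0<q = ℕ.<⇒≤ 1<q
  a = λ k → indicator (gcd (suc k) n ≟ 1)
  mult : ℕ → ℕ → ℕ
  mult d k = indicator (d ∣? suc k)
  perm₁ : ∀ q r p → q * r * p ≡ p * q * r
  perm₁ = solveℕ-∀
  perm₂ : ∀ p r q → p * r * q ≡ p * q * r
  perm₂ = solveℕ-∀
  count : ∀ d → 0 < d → ∀ m → m * d ≡ n → m ≡ ∑ (mult d) n
  count d 0<d m eq = trans (sym (∑-multiples d 0<d m)) (cong (∑ (mult d)) eq)
  not-coprime : ∀ {d k} → 1 < d → d ∣ n → d ∣ suc k → a k ≡ 0
  not-coprime {d} {k} 1<d d∣n d∣k = indicator-no (gcd (suc k) n ≟ 1) λ gcd≡1 →
    contradiction (∣1⇒≡1 (subst (d ∣_) gcd≡1 (gcd-greatest d∣k d∣n))) (ℕ.>⇒≢ 1<d)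
  p∣n : p ∣ n
  p∣n = ∣-trans (m∣m*n {p} q) (m∣m*n r)
  q∣n : q ∣ n
  q∣n = n∣m*n*o p r
  indicator≤1 : ∀ {ℓ} {A : Set ℓ} (a? : Dec A) → indicator a? ≤ 1
  indicator≤1 (yes _) = ℕ.≤-refl
  indicator≤1 (no _)  = z≤n
  -- A multiple of p or of q shares a factor with n, so it is not counted by `a`; a common multiple
  -- is counted twice on the left and compensated by `mult (p * q)`.
  pointwise : ∀ k → a k + (mult p k + mult q k) ≤ 1 + mult (p * q) k
  pointwise k with p ∣? suc k | q ∣? suc k
  ... | yes p∣k | yes q∣k = ℕ.≤-reflexive (trans (cong (_+ 2) (not-coprime 1<p p∣n p∣k))
          (cong suc (sym (indicator-yes (p * q ∣? suc k) (coprime-*-∣ cop p∣k q∣k)))))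
  ... | yes p∣k | no _    = ℕ.≤-trans (ℕ.≤-reflexive (cong (_+ 1) (not-coprime 1<p p∣n p∣k))) (s≤s z≤n)
  ... | no _    | yes q∣k = ℕ.≤-trans (ℕ.≤-reflexive (cong (_+ 1) (not-coprime 1<q q∣n q∣k))) (s≤s z≤n)
  ... | no _    | no _    = ℕ.≤-trans (ℕ.≤-reflexive (ℕ.+-identityʳ (a k)))
          (ℕ.≤-trans (indicator≤1 (gcd (suc k) n ≟ 1)) (s≤s z≤n))

-- Value sets and auxiliary arithmetic

∣·∣≤⇒ : ∀ {n} v → ℤ.∣ v ∣ ≤ n → (ℤ.- (+ n) ℤ.≤ v) × (v ℤ.≤ + n)
∣·∣≤⇒ {n}     (+ m)    m≤n       = ℤ.≤-trans (ℤ.neg-mono-≤ (ℤ.+≤+ {0} {n} z≤n)) (ℤ.+≤+ z≤n) , ℤ.+≤+ m≤n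
∣·∣≤⇒ {suc n} -[1+ m ] (s≤s m≤n) = ℤ.-≤- m≤n , ℤ.-≤+

values⇔ : ∀ P (f : Seq) K → (∀ k → ℤ.∣ f k ∣ ≤ suc P) →
  (∀ m → m ≤ P → ∃[ k ] (k ≤ K × f k ≡ + suc m)) →
  (∀ m → m ≤ P → ∃[ k ] (k ≤ K × f k ≡ -[1+ m ])) →
  ∃[ k ] (k ≤ K × f k ≡ + 0) →
  ∀ v → (∃[ k ] (k ≤ K × f k ≡ v)) ⇔ ((ℤ.- (+ suc P) ℤ.≤ v) × (v ℤ.≤ + suc P))
values⇔ P f K bounded pos neg null v = mk⇔ (λ { (k , _ , refl) → ∣·∣≤⇒ (f k) (bounded k) }) (attained v)
  where
  attained : ∀ v → (ℤ.- (+ suc P) ℤ.≤ v) × (v ℤ.≤ + suc P) → ∃[ k ] (k ≤ K × f k ≡ v)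
  attained (+ zero)   _                          = null
  attained (+ suc m)  (_ , ℤ.+≤+ (s≤s m≤P))      = pos m m≤P
  attained -[1+ m ]   (ℤ.-≤- m≤P , _)            = neg m m≤P

-- The hypothesis is the case i = P. Descending from P to i = P - d takes dr off the left side but
-- only dQ ≤ dr off the right.
scaled-< : ∀ {P Q r i} → Q ≤ r → r * P < suc P * Q → i ≤ P → i * r < suc i * Q
scaled-< {P} {Q} {r} {i} Q≤r rP< i≤P with ℕ.m≤n⇒∃[o]m+o≡n i≤P
... | d , refl = ℕ.≰⇒> λ iQ≤ir → ℕ.<⇒≱ rP< (begin
  suc (i + d) * Q        ≡⟨ expand i d Q ⟩
  suc i * Q + d * Q      ≤⟨ ℕ.+-mono-≤ iQ≤ir (ℕ.*-monoʳ-≤ d Q≤r) ⟩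
  i * r + d * r          ≡⟨ collect i d r ⟩
  r * (i + d)            ∎)
  where
  open ℕ.≤-Reasoning
  expand : ∀ i d Q → (1 + (i + d)) * Q ≡ (1 + i) * Q + d * Q
  expand = solveℕ-∀
  collect : ∀ i d r → i * r + d * r ≡ r * (i + d)
  collect = solveℕ-∀

even-or-odd : ∀ n → 2 ∣ n ⊎ 2 ∣ suc n
even-or-odd zero    = inj₁ (2 ∣0)
even-or-odd (suc n) = [ (λ 2∣n → inj₂ (∣m∣n⇒∣m+n ∣-refl 2∣n)) , inj₁ ]′ (even-or-odd n)

-- Evaluation of the coefficients, with P = p - 2

module Coefficients (P q r : ℕ) (pp : Prime (suc (suc P))) (pq : Prime q) (pr : Prime r)
  (2<p : 2 < suc (suc P)) (p<q : suc (suc P) < q) (q<r : q < r)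
  (r< : r * P < suc P * (q ∸ 1)) (2p≤1+q : suc (suc P) + suc (suc P) ≤ suc q) where

  private
    p = suc (suc P)
    cop = primes-coprime pp pq p<q
    1<p = 1<prime pp
    1<q = 1<prime pq
    a = A p q
    W = U p r a
    n = p * q * r
    0<q = ℕ.<⇒≤ 1<q
    r<pq : r < p * q
    r<pq = begin-strict
      r                ≡⟨ ℕ.*-identityʳ r ⟨
      -- From p > 2 one has P ≥ 1, so the bound on rP bounds r as well.
      r * 1            ≤⟨ ℕ.*-monoʳ-≤ r (ℕ.≤-pred (ℕ.≤-pred 2<p)) ⟩
      r * P            <⟨ r< ⟩
      suc P * (q ∸ 1)  ≤⟨ ℕ.*-mono-≤ (ℕ.n≤1+n (suc P)) (ℕ.m∸n≤m q 1) ⟩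
      p * q            ∎
      where open ℕ.≤-Reasoning

    c≡ : ∀ k → c n k ≡ S (q * r) W k ℤ.- W k
    c≡ k = trans (Psi-pqr-coeff pp pq pr p<q q<r r<pq k) (act-xnMinus1 (q * r) W k)

    degree≤ : suc (suc P * q) ≤ suc P * r
    degree≤ = ℕ.*-monoʳ-< (suc P) q<r

    a-vanish : ∀ k → suc P * r ≤ k → a k ≡ + 0
    a-vanish k l = A-vanish cop 1<p k (ℕ.≤-trans degree≤ l)

    -- Here 2p - 1 ≤ q is used. It makes the two copies of `W` in (x^(qr) - 1)W disjoint, so each
    -- coefficient of Ψ_pqr is plus or minus one coefficient of `W`.
    W-vanish : ∀ k → q * r ≤ k → W k ≡ + 0
    W-vanish k qr≤k = U-vanish p r a a-vanish k (begin
      p * r + suc P * r  ≡⟨ ℕ.*-distribʳ-+ r p (suc P) ⟨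
      (p + suc P) * r    ≤⟨ ℕ.*-monoˡ-≤ r (ℕ.≤-pred (subst (_≤ suc q) (ℕ.+-suc p (suc P)) 2p≤1+q)) ⟩
      q * r              ≤⟨ qr≤k ⟩
      k                  ∎)
      where open ℕ.≤-Reasoning

    c-low : ∀ k → k < q * r → c n k ≡ ℤ.- W k
    c-low k k<qr = trans (c≡ k) (trans (cong (ℤ._- W k) (S-below (q * r) W k<qr)) (ℤ.+-identityˡ _))

    c-high : ∀ k → c n (q * r + k) ≡ W k
    c-high k = trans (c≡ (q * r + k)) (trans
      (cong₂ ℤ._-_ (S-above (q * r) W k) (W-vanish (q * r + k) (ℕ.m≤m+n (q * r) k)))
      (ℤ.+-identityʳ _))

  c-bounded : ∀ k → ℤ.∣ c n k ∣ ≤ suc P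
  c-bounded k = [ low , high ]′ (ℕ.<-≤-connex k (q * r))
    where
    W-bounded = U-bounded p r a (A-bounded cop 1<p) (suc P) a-vanish
    low : k < q * r → ℤ.∣ c n k ∣ ≤ suc P
    low k<qr = subst (_≤ suc P) (sym (trans (cong ℤ.∣_∣ (c-low k k<qr)) (ℤ.∣-i∣≡∣i∣ (W k)))) (W-bounded k)
    high : q * r ≤ k → ℤ.∣ c n k ∣ ≤ suc P
    high qr≤k with ℕ.m≤n⇒∃[o]m+o≡n qr≤k
    ... | j , refl = subst (λ z → ℤ.∣ z ∣ ≤ suc P) (sym (c-high j)) (W-bounded j)

  -- Because 2 < r only one summand is present, and it is `χ p q 1` minus `χ p q 2`; both 1 and 2
  -- are gaps, as they lie strictly between 0 and p.
  c-2 : c n 2 ≡ + 0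
  c-2 = trans (c-low 2 2<qr) (cong ℤ.-_ (trans (U-low (suc P) r a 2<r) (trans (A-≡ p q 2)
    (cong₂ ℤ._-_ (χ-small 1 (s≤s z≤n) 1<p) (χ-small 2 (s≤s z≤n) 2<p)))))
    where
    2<r = ℕ.<-trans 2<p (ℕ.<-trans p<q q<r)
    2<qr = ℕ.<-≤-trans 2<r (ℕ.m≤n*m r q ⦃ >-nonZero 0<q ⦄)
    χ-small : ∀ k → 0 < k → k < p → χ p q k ≡ + 0
    χ-small k 0<k k<p = U-none p q (inv p) k λ
      { {zero}  i _ k≡ → inv-∤ {p} {i} λ p∣i → ℕ.<⇒≱ k<p (∣⇒≤ ⦃ >-nonZero 0<k ⦄ (subst (p ∣_) (sym (trans k≡ (ℕ.+-identityʳ i))) p∣i))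
      ; {suc j} i _ k≡ → contradiction (begin
          q              ≤⟨ ℕ.m≤m+n q (j * q) ⟩
          suc j * q      ≤⟨ ℕ.m≤n+m (suc j * q) i ⟩
          i + suc j * q  ≡⟨ k≡ ⟨
          k              ∎) (ℕ.<⇒≱ (ℕ.<-trans k<p p<q)) }
      where open ℕ.≤-Reasoning

  -- The totient bound gives n - φ(n) ≥ (p + q - 1)r. This admits every index o + (m + q)r with o <
  -- r and m ≤ p - 2.
  degree-bound : ∀ {k} → k ≤ (suc P + q) * r → k ≤ n ∸ totient n
  degree-bound {k} k≤ = ℕ.m+n≤o⇒m≤o∸n k (ℕ.+-cancelʳ-≤ r _ _ (begin
    k + totient n + r                         ≤⟨ ℕ.+-monoˡ-≤ r (ℕ.+-monoˡ-≤ (totient n) k≤) ⟩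
    (suc P + q) * r + totient n + r           ≡⟨ rearrange P q r (totient n) ⟩
    totient n + (q * r + p * r)               ≤⟨ totient-pqr r cop 1<p 1<q ⟩
    n + r                                     ∎))
    where
    open ℕ.≤-Reasoning
    rearrange : ∀ P q r t → (1 + P + q) * r + t + r ≡ t + (q * r + (2 + P) * r)
    rearrange = solveℕ-∀

  block≤ : ∀ {o m} M → o < r → m ≤ M → o + m * r ≤ suc M * r
  block≤ {o} {m} M o<r m≤M = ℕ.+-mono-≤ (ℕ.<⇒≤ o<r) (ℕ.*-monoˡ-≤ r m≤M)

  -- The pair (o, ε) will be (0, 1) for residues -1 and (1, -1) for residues 1. The partial sums
  -- along the progression are then the multiples of ε, negated in the copy below x^(qr).
  module OnProgression (o : ℕ) (o<r : o < r) (ε : ℤ) (a-constant : ∀ i → i ≤ P → a (o + i * r) ≡ ε) where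

    private
      W-value : ∀ m → m ≤ P → W (o + m * r) ≡ + suc m ℤ.* ε
      W-value m m≤P = U-constant p r a o ε m o<r (s≤s (ℕ.m≤n⇒m≤1+n m≤P))
        (λ i i≤m → a-constant i (ℕ.≤-trans i≤m m≤P))

    c-first : ∀ m → m ≤ P → c n (o + m * r) ≡ ℤ.- (+ suc m ℤ.* ε)
    c-first m m≤P = trans (c-low (o + m * r) (begin-strict
      o + m * r    <⟨ ℕ.+-monoˡ-< (m * r) o<r ⟩
      suc m * r    ≤⟨ ℕ.*-monoˡ-≤ r (ℕ.≤-trans (s≤s (ℕ.m≤n⇒m≤1+n m≤P)) (ℕ.<⇒≤ p<q)) ⟩
      q * r        ∎)) (cong ℤ.-_ (W-value m m≤P))
      where open ℕ.≤-Reasoning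

    c-second : ∀ m → m ≤ P → c n (o + (m + q) * r) ≡ + suc m ℤ.* ε
    c-second m m≤P = trans (cong (c n) (rearrange o m q r)) (trans (c-high (o + m * r)) (W-value m m≤P))
      where
      rearrange : ∀ o m q r → o + (m + q) * r ≡ q * r + (o + m * r)
      rearrange = solveℕ-∀

    first≤ : ∀ m → m ≤ P → o + m * r ≤ n ∸ totient n
    first≤ m m≤P = degree-bound (ℕ.≤-trans (block≤ P o<r m≤P) (ℕ.*-monoˡ-≤ r (ℕ.m≤m+n (suc P) q)))

    second≤ : ∀ m → m ≤ P → o + (m + q) * r ≤ n ∸ totient n
    second≤ m m≤P = degree-bound (block≤ (P + q) o<r (ℕ.+-monoˡ-≤ q m≤P))

  2≤ : 2 ≤ n ∸ totient n
  2≤ = degree-bound (ℕ.≤-trans (ℕ.<⇒≤ 2<p) (ℕ.≤-trans (ℕ.<⇒≤ p<q) (ℕ.≤-trans (ℕ.<⇒≤ q<r)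
    (ℕ.m≤n*m r (suc P + q)))))

  module Congruent (t : ℕ) (r≡ : r ≡ q + t * p) where

    private
      -- Since r ≡ q (mod p), iq is the Apéry element of the class of ir, and iq ≤ ir.
      χ-ir : ∀ i → i ≤ P → χ p q (i * r) ≡ ℤ.-1ℤ
      χ-ir i i≤P = χ-member cop {i} {i * t} {0} (s≤s (ℕ.m≤n⇒m≤1+n i≤P))
        (trans (expand i q t p) (trans (cong (i *_) (sym r≡)) (sym (ℕ.+-identityʳ (i * r)))))
        (ℕ.*-monoʳ-≤ i (ℕ.<⇒≤ q<r))
        where
        expand : ∀ i q t p → i * q + i * t * p ≡ i * (q + t * p)
        expand = solveℕ-∀

      -- The bound on r, scaled down to i, gives 1 + ir ≤ (i+1)(q-1); replacing q - 1 by q makes the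
      -- inequality strict.
      1+ir<[1+i]q : ∀ i → i ≤ P → 1 + i * r < suc i * q
      1+ir<[1+i]q i i≤P = ℕ.≤-<-trans
        (scaled-< (ℕ.≤-trans (ℕ.m∸n≤m q 1) (ℕ.<⇒≤ q<r)) r< i≤P)
        (ℕ.*-monoʳ-< (suc i) (ℕ.∸-monoʳ-< {q} {1} {0} (s≤s z≤n) 0<q))

      suc-expand : ∀ i q t p → suc i * q + i * t * p ≡ i * (q + t * p) + q
      suc-expand = solveℕ-∀

    -- With q ≡ -1 one has ir - 1 ≡ (i+1)q (mod p), and (i+1)q is too large: ir - 1 is a gap while
    -- ir is a member. The index i + 1 stays below p because i ≤ p - 2.
    A-values₋₁ : ∀ u → q + 1 ≡ u * p → ∀ i → i ≤ P → a (i * r) ≡ + 1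
    A-values₋₁ u q≡ i i≤P = trans (A-≡ p q (i * r)) (cong₂ ℤ._-_ (before i i≤P) (χ-ir i i≤P))
      where
      gap : ∀ i k → i ≤ P → suc k ≡ i * r → χ p q k ≡ + 0
      gap i k i≤P k≡ = χ-gap cop {suc i} {i * t} {u} (s≤s (s≤s i≤P)) (begin
        suc i * q + i * t * p   ≡⟨ suc-expand i q t p ⟩
        i * (q + t * p) + q     ≡⟨ cong (λ z → i * z + q) r≡ ⟨
        i * r + q               ≡⟨ cong (_+ q) k≡ ⟨
        suc k + q               ≡⟨ cong suc (ℕ.+-comm k q) ⟩
        suc (q + k)             ≡⟨ shuffle q k ⟩
        k + (q + 1)             ≡⟨ cong (_+_ k) q≡ ⟩
        k + u * p               ∎)
        (ℕ.<-trans (ℕ.≤-reflexive k≡) (ℕ.<-trans ℕ.≤-refl (1+ir<[1+i]q i i≤P)))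
        where
        open ≡-Reasoning
        shuffle : ∀ q k → 1 + (q + k) ≡ k + (q + 1)
        shuffle = solveℕ-∀
      -- At i = 0 the argument has no predecessor, and `shift` supplies the value 0.
      shift-gap : ∀ i k → i ≤ P → k ≡ i * r → shift (χ p q) k ≡ + 0
      shift-gap i zero    i≤P k≡ = refl
      shift-gap i (suc k) i≤P k≡ = gap i k i≤P k≡
      before : ∀ i → i ≤ P → shift (χ p q) (i * r) ≡ + 0
      before i i≤P = shift-gap i (i * r) i≤P refl

    -- With q ≡ 1 one has 1 + ir ≡ (i+1)q (mod p), so now ir is the member and its successor the
    -- gap, which reverses the sign.
    A-values₁ : ∀ u → q ≡ 1 + u * p → ∀ i → i ≤ P → a (1 + i * r) ≡ ℤ.-1ℤ
    A-values₁ u q≡ i i≤P = trans (A-≡ p q (1 + i * r)) (cong₂ ℤ._-_ (χ-ir i i≤P)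
      (χ-gap cop {suc i} {i * t} {u} (s≤s (s≤s i≤P)) (begin
        suc i * q + i * t * p   ≡⟨ suc-expand i q t p ⟩
        i * (q + t * p) + q     ≡⟨ cong (λ z → i * z + q) r≡ ⟨
        i * r + q               ≡⟨ cong (_+_ (i * r)) q≡ ⟩
        i * r + (1 + u * p)     ≡⟨ ℕ.+-suc (i * r) (u * p) ⟩
        1 + i * r + u * p       ∎)
        (1+ir<[1+i]q i i≤P)))
      where open ≡-Reasoning

theorem4 : (p q r : ℕ) → Prime p → Prime q → Prime r →
    ¬ (2 ∣ p) → ¬ (2 ∣ q) → ¬ (2 ∣ r) → p < q → q < r →
    r * (p ∸ 2) < (p ∸ 1) * (q ∸ 1) →
    ((p ∣ q + 1) → (p ∣ r + 1) →
      ((m : ℕ) → m ≤ p ∸ 2 →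
        (c (p * q * r) (m * r) ≡ -[1+ m ]) × (c (p * q * r) ((m + q) * r) ≡ + (suc m)))
      × (c (p * q * r) 2 ≡ + 0)
      × ((v : ℤ) → (∃[ k ] (k ≤ p * q * r ∸ totient (p * q * r) × c (p * q * r) k ≡ v))
                     ⇔ ((ℤ.- (+ (p ∸ 1)) ℤ.≤ v) × (v ℤ.≤ + (p ∸ 1)))))
    × ((p ∣ q ∸ 1) → (p ∣ r ∸ 1) →
      ((m : ℕ) → m ≤ p ∸ 2 →
        (c (p * q * r) (1 + m * r) ≡ + (suc m)) × (c (p * q * r) (1 + (m + q) * r) ≡ -[1+ m ]))
      × (c (p * q * r) 2 ≡ + 0)
      × ((v : ℤ) → (∃[ k ] (k ≤ p * q * r ∸ totient (p * q * r) × c (p * q * r) k ≡ v))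
                     ⇔ ((ℤ.- (+ (p ∸ 1)) ℤ.≤ v) × (v ℤ.≤ + (p ∸ 1)))))
theorem4 zero          q r pp = contradiction pp ¬prime[0]
theorem4 (suc zero)    q r pp = contradiction pp ¬prime[1]
theorem4 (suc (suc P)) q r pp pq pr 2∤p 2∤q 2∤r p<q q<r r< = part-i , part-ii
  where
  p = suc (suc P)
  n = p * q * r
  d = r ∸ q
  r≡q+d : r ≡ q + d
  r≡q+d = sym (ℕ.m+[n∸m]≡n (ℕ.<⇒≤ q<r))
  0<q : 0 < q
  0<q = ℕ.<⇒≤ (1<prime pq)
  1<r : 1 < r
  1<r = 1<prime pr
  2<p : 2 < p
  2<p = ℕ.≤∧≢⇒< (1<prime pp) λ 2≡p → 2∤p (∣-reflexive 2≡p)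
  *1 : ∀ m → + suc m ℤ.* + 1 ≡ + suc m
  *1 m = ℤ.*-identityʳ (+ suc m)
  *-1 : ∀ m → + suc m ℤ.* ℤ.-1ℤ ≡ -[1+ m ]
  *-1 m = trans (ℤ.*-comm (+ suc m) ℤ.-1ℤ) (ℤ.-1*i≡-i (+ suc m))
  p+p≤ : ∀ u → p + p ≤ suc (suc u) * p
  p+p≤ u = ℕ.+-monoʳ-≤ p (ℕ.m≤m+n p (u * p))

  part-i : p ∣ q + 1 → p ∣ r + 1 →
    ((m : ℕ) → m ≤ P → (c n (m * r) ≡ -[1+ m ]) × (c n ((m + q) * r) ≡ + suc m)) ×
    (c n 2 ≡ + 0) ×
    ((v : ℤ) → (∃[ k ] (k ≤ n ∸ totient n × c n k ≡ v)) ⇔ ((ℤ.- (+ suc P) ℤ.≤ v) × (v ℤ.≤ + suc P)))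
  part-i p∣q+1@(divides u q≡) p∣r+1 = (λ m m≤P → first m m≤P , second m m≤P) , c-2
    , values⇔ P (c n) _ c-bounded
        (λ m m≤P → _ , second≤ m m≤P , second m m≤P)
        (λ m m≤P → _ , first≤ m m≤P , first m m≤P)
        (2 , 2≤ , c-2)
    where
    two-periods : ∀ u → q + 1 ≡ u * p → p + p ≤ suc q
    two-periods zero          q≡ = contradiction (trans (ℕ.+-comm 1 q) q≡) λ ()
    -- The quotient (q + 1)/p = 1 would give q < p.
    two-periods (suc zero)    q≡ = contradiction (ℕ.<-trans p<q (ℕ.≤-reflexive (trans (ℕ.+-comm 1 q) (trans q≡ (ℕ.+-identityʳ p)))))
                                              (ℕ.<-irrefl refl)
    two-periods (suc (suc u)) q≡ = ℕ.≤-trans (p+p≤ u) (ℕ.≤-reflexive (trans (sym q≡) (ℕ.+-comm q 1)))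
    2p≤ = two-periods u q≡
    p∣d : p ∣ d
    p∣d = ∣m+n∣m⇒∣n (subst (p ∣_) (trans (cong (_+ 1) r≡q+d) (xy∙z≈xz∙y q d 1)) p∣r+1) p∣q+1
    open Coefficients P q r pp pq pr 2<p p<q q<r r< 2p≤
    open Congruent (quotient p∣d) (trans r≡q+d (cong (_+_ q) (_∣_.equality p∣d)))
    constant : ∀ i → i ≤ P → A p q (i * r) ≡ + 1
    constant = A-values₋₁ u q≡
    open OnProgression 0 (ℕ.<⇒≤ 1<r) (+ 1) constant
    first : ∀ m → m ≤ P → c n (m * r) ≡ -[1+ m ]
    first m m≤P = trans (c-first m m≤P) (cong ℤ.-_ (*1 m))
    second : ∀ m → m ≤ P → c n ((m + q) * r) ≡ + suc m
    second m m≤P = trans (c-second m m≤P) (*1 m)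

  part-ii : p ∣ q ∸ 1 → p ∣ r ∸ 1 →
    ((m : ℕ) → m ≤ P → (c n (1 + m * r) ≡ + suc m) × (c n (1 + (m + q) * r) ≡ -[1+ m ])) ×
    (c n 2 ≡ + 0) ×
    ((v : ℤ) → (∃[ k ] (k ≤ n ∸ totient n × c n k ≡ v)) ⇔ ((ℤ.- (+ suc P) ℤ.≤ v) × (v ℤ.≤ + suc P)))
  part-ii p∣q-1@(divides u q-1≡) p∣r-1 = (λ m m≤P → first m m≤P , second m m≤P) , c-2
    , values⇔ P (c n) _ c-bounded
        (λ m m≤P → _ , first≤ m m≤P , first m m≤P)
        (λ m m≤P → _ , second≤ m m≤P , second m m≤P)
        (2 , 2≤ , c-2)
    where
    q≡ : q ≡ 1 + u * p
    q≡ = trans (sym (ℕ.m+[n∸m]≡n 0<q)) (cong suc q-1≡)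
    two-periods : ∀ u → q ≡ 1 + u * p → p + p ≤ suc q
    two-periods zero          q≡ = contradiction (1<prime pq) (ℕ.<-irrefl (sym q≡))
    -- The quotient (q - 1)/p = 1 would give q = p + 1, which is even because p is odd.
    two-periods (suc zero)    q≡ = contradiction
      (subst (2 ∣_) (sym (trans q≡ (cong suc (ℕ.+-identityʳ p)))) (fromInj₂ (λ 2∣p → contradiction 2∣p 2∤p) (even-or-odd p))) 2∤q
    two-periods (suc (suc u)) q≡ = ℕ.≤-trans (p+p≤ u) (ℕ.≤-trans (ℕ.n≤1+n _) (ℕ.≤-trans (ℕ.≤-reflexive (sym q≡)) (ℕ.n≤1+n q)))
    2p≤ = two-periods u q≡
    p∣d : p ∣ d
    p∣d = ∣m+n∣m⇒∣n (subst (p ∣_) (trans (cong (_∸ 1) r≡q+d) (ℕ.+-∸-comm d 0<q)) p∣r-1) p∣q-1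
    open Coefficients P q r pp pq pr 2<p p<q q<r r< 2p≤
    open Congruent (quotient p∣d) (trans r≡q+d (cong (_+_ q) (_∣_.equality p∣d)))
    constant : ∀ i → i ≤ P → A p q (1 + i * r) ≡ ℤ.-1ℤ
    constant = A-values₁ u q≡
    open OnProgression 1 1<r ℤ.-1ℤ constant
    first : ∀ m → m ≤ P → c n (1 + m * r) ≡ + suc m
    first m m≤P = trans (c-first m m≤P) (cong ℤ.-_ (*-1 m))
    second : ∀ m → m ≤ P → c n (1 + (m + q) * r) ≡ -[1+ m ]
    second m m≤P = trans (c-second m m≤P) (*-1 m)
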